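{- Let $S$ be a finite multiset of integers and let $d\ge 0$. There is a bijection between dual Dyck factorizations $\mathcal F=(F_0,F_1,\ldots)$ of the multiset $S$ satisfying $\mathrm{di}(F_0F_1\cdots)=d$ and pairs $(P,Q)$ such that: (i) $P$ is a Dyck tableau with entries exactly the multiset $S$ and $\mathrm{di}(\mathrm{RR}(P))=d$; (ii) $Q$ is a semistandard Young tableau (with entries in $\{0,1,2,\ldots\}$) of the same shape as $P$; (iii) the content of $Q$ records the factorization weight, meaning that if $\mathcal F$ corresponds to $(P,Q)$ then $m_i(Q)=|F_i|$ for every $i\ge 0$. Equivalently (for (iii)), the bijection sends the factorization monomial $\prod_{i\ge 0}x_i^{|F_i|}$ to the semistandard-tableau weight of $Q$.
   Context: Sequences are finite integer sequences indexed from $0$, possibly empty; $|F|$ is the length of $F$. For $x=(x_0,\ldots,x_{m-1})$, $\mathrm{di}(x)=\#\{(i,j):0\le i<j<m,\ x_i=x_j+1\}$. A sequence $x$ is dual Dyck if $x_{i+1}\ge x_i+2$ for all $0\le i<m-1$. A factorization of $S$ is an ordered sequence $\mathcal F=(F_0,F_1,F_2,\ldots)$ of finite sequences, all but finitely many empty, such that the concatenation $F_0F_1F_2\cdots$ is a permutation (rearrangement) of the multiset $S$; it is a dual Dyck factorization if each $F_i$ is a dual Dyck sequence. A Dyck tableau is a left-aligned tableau with rows $T_0,T_1,\ldots,T_{\ell-1}$ from top to bottom (nonempty rows; the tableau with no rows is allowed), with $|T_0|\ge|T_1|\ge\cdots\ge|T_{\ell-1}|$, such that each row read left to right is a dual Dyck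 sequence, and whenever adjacent rows $T_j$ and $T_{j+1}$ both have an entry in column $p$, $T_j[p]\le T_{j+1}[p]+1$. Its row-reading word is $\mathrm{RR}(P)=T_{\ell-1}T_{\ell-2}\cdots T_0$ (rows read left to right, bottom row first). Its shape $\lambda(P)$ is the partition of row lengths. A semistandard Young tableau has rows weakly increasing left to right and columns strictly increasing top to bottom; $m_i(Q)$ is the number of entries of $Q$ equal to $i$, and the weight of $Q$ is $\prod_{i\ge0}x_i^{m_i(Q)}$. -}

module Defs where

open import Data.Integer as ℤ using (ℤ; +_)
open import Data.List using (List; []; _∷_; map; length; filter; concat; reverse; zip; applyUpTo)
open import Data.List.Relation.Binary.Permutation.Propositional using (_↭_)
open import Data.List.Relation.Unary.All using (All)
open import Data.List.Relation.Unary.Linked using (Linked)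
open import Data.Nat as ℕ using (ℕ; _+_; _≤_; _<_; _≥_)
open import Data.Product using (_,_; uncurry)
open import Level using (0ℓ)
open import Relation.Binary using (Rel; Setoid)
open import Relation.Binary.PropositionalEquality using (_≡_; _≢_; setoid; _→-setoid_)
open import Data.Product.Relation.Binary.Pointwise.NonDependent using (×-setoid)
import Relation.Binary.Construct.On as On

-- A finite multiset of integers is represented by a list, and equality of
-- multisets is _↭_.

-- The pairs i < j with xᵢ = xⱼ + 1, counted according to the value of i.
di : List ℤ → ℕ
di []       = 0
di (x ∷ xs) = length (filter (λ y → x ℤ.≟ y ℤ.+ + 1) xs) + di xs

DualDyck : List ℤ → Set
DualDyck = Linked (λ a b → b ℤ.≥ a ℤ.+ + 2)

-- A sequence F₀, F₁, F₂, … of finite sequences, all but finitely many empty.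
record FiniteSeq : Set where
  field
    factor   : ℕ → List ℤ
    bound    : ℕ
    vanishes : ∀ i → bound ≤ i → factor i ≡ []

  -- F₀ F₁ F₂ ⋯; the factors omitted here are empty, so the value does not
  -- depend on the choice of bound.
  product : List ℤ
  product = concat (applyUpTo factor bound)

record DualDyckFactorization (S : List ℤ) (d : ℕ) : Set where
  field
    factors    : FiniteSeq
  open FiniteSeq factors public
  field
    factorizes : product ↭ S
    dualDyck   : ∀ i → DualDyck (factor i)
    di-product : di product ≡ d

-- Factorizations are identified when they agree factor by factor; the bound
-- and the proofs are ignored.
DualDyckFactorizations : List ℤ → ℕ → Setoid 0ℓ 0ℓ
DualDyckFactorizations S d =
  On.setoid (ℕ →-setoid List ℤ) (DualDyckFactorization.factor {S} {d})

-- A left-aligned tableau of partition shape, given by its rows from top to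
-- bottom.
record Tableau (A : Set) : Set where
  field
    rows       : List (List A)
    nonempty   : All (_≢ []) rows
    decreasing : Linked (λ upper lower → length upper ≥ length lower) rows

  shape : List ℕ
  shape = map length rows

  entries : List A
  entries = concat rows

-- Since zip truncates to the shorter row, this relates the entries of two
-- adjacent rows in exactly those columns where both rows have an entry.
Columnwise : {A : Set} → Rel A 0ℓ → Rel (List A) 0ℓ
Columnwise R upper lower = All (uncurry R) (zip upper lower)

record DyckTableau : Set where
  field
    tableau : Tableau ℤ
  open Tableau tableau public
  field
    rowsDualDyck : All DualDyck rows
    columns      : Linked (Columnwise (λ a b → a ℤ.≤ b ℤ.+ + 1)) rows

  -- Row-reading word: rows from bottom to top, each read left to right.
  RR : List ℤ
  RR = concat (reverse rows)

record SSYT : Set where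
  field
    tableau : Tableau ℕ
  open Tableau tableau public
  field
    rowsWeak      : All (Linked _≤_) rows
    columnsStrict : Linked (Columnwise _<_) rows

  -- m i is the number of entries equal to i.
  m : ℕ → ℕ
  m i = length (filter (i ℕ.≟_) entries)

record TableauPair (S : List ℤ) (d : ℕ) : Set where
  field
    P         : DyckTableau
    Q         : SSYT
    entries-P : DyckTableau.entries P ↭ S
    di-RR     : di (DyckTableau.RR P) ≡ d
    sameShape : SSYT.shape Q ≡ DyckTableau.shape P

-- Pairs are identified when both tableaux have the same rows; the proofs are
-- ignored.
TableauPairs : List ℤ → ℕ → Setoid 0ℓ 0ℓ
TableauPairs S d =
  On.setoid (×-setoid (setoid (List (List ℤ))) (setoid (List (List ℕ))))
            (λ (t : TableauPair S d) →
               DyckTableau.rows (TableauPair.P t) , SSYT.rows (TableauPair.Q t))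

{-# OPTIONS --safe #-}

-- An RSK-type row insertion. A dual Dyck sequence is a 0/1 word without adjacent ones. In the union of
-- a row u and a factor v to be inserted, maximal blocks of consecutive values alternate between u and v
-- (or consist of one common value). Bracket each block having one more letter of v with a later block
-- having one more letter of u, and interchange the two words on the blocks of the second kind that
-- remain unmatched. The word v′ that replaces v becomes the new row, and the word u′ that replaces u is
-- inserted into the next row. In an alternating block of odd length, half of the pairs of consecutive
-- values have the larger one in u and half in v, so di of u v and of u′ v′ agree. Given |v′| - |u|, which
-- the recording tableau stores, the same rule read from right to left undoes the insertion. The column
-- condition for v′ above u′ says that no block with one more letter of u′ remains unmatched; its
-- propagation from one pair of rows to the next is an invariant on prefix counts of three words, and the
-- converse propagation is the same statement for the reversed words.

module Submission where

open import Defs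
open import Data.Bool using (Bool; true; false; not)
open import Data.Empty using (⊥; ⊥-elim)
open import Data.Integer as ℤ using (ℤ; +_; -[1+_])
import Data.Integer.Properties as ℤ
open import Data.List
  using (List; []; _∷_; [_]; _++_; _∷ʳ_; _ʳ++_; applyUpTo; concat; filter; length; map; replicate; reverse)
import Data.List.Extrema.Nat as ℕ-Extrema
open import Data.List.Extrema ℤ.≤-totalOrder using (min; max; min≤xs; xs≤max)
open import Data.List.Properties
  using (++-assoc; ++-identityʳ; ∷-injective; ∷-injectiveˡ; ∷ʳ-++; applyUpTo-∷ʳ; concat-++;
         filter-++; filter-accept; filter-all; filter-none; filter-reject; length-++; length-replicate;
         reverse-injective; reverse-involutive; unfold-reverse; zipWith-zeroʳ)
open import Data.List.Relation.Binary.Permutation.Propositional as Perm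
  using (_↭_; ↭-prep; ↭-refl; ↭-reflexive; ↭-sym; ↭-trans)
open import Data.List.Relation.Binary.Permutation.Propositional.Properties
  using (++⁺; ++⁺ˡ; ++-comm; All-resp-↭; filter-↭; shift; ↭-length)
open import Data.List.Relation.Unary.All as All using (All; []; _∷_)
import Data.List.Relation.Unary.All.Properties as All
open import Data.List.Relation.Unary.Linked as Linked using (Linked; []; [-]; _∷_)
import Data.List.Relation.Unary.Linked.Properties as Linked
open import Data.Nat using (ℕ; zero; suc; pred; _+_; _∸_; _≤_; _≥_; _<_; z≤n; s≤s; s≤s⁻¹)
open import Data.Nat.Properties
open import Data.Nat.Solver using (module +-*-Solver)
open import Data.Product using (∃-syntax; Σ-syntax; _×_; _,_; proj₁; proj₂)
open import Data.Product.Properties using (,-injective)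
open import Data.Sum as Sum using (_⊎_; inj₁; inj₂)
open import Data.Unit using (⊤; tt)
open import Function using (_∘_)
open import Function.Bundles using (Bijection)
open import Relation.Binary using (Setoid)
open import Relation.Binary.PropositionalEquality
  using (_≡_; _≢_; cong; cong₂; module ≡-Reasoning; refl; subst; subst₂; sym; trans)
open import Relation.Nullary using (contradiction; no; yes)

-- Words, runs and Dyck pairs.

pattern O = false
pattern I = true

-- While reading u and v from left to right, the counter c is the number of ones of v minus the number of
-- ones of u′ read so far. The constructors record the last letter: low if it belongs to u, high if to v,
-- both if to both, idle if to none. After low the counter is c - 1, so that low 0 requires a letter of v
-- next. The starred states lie inside an interchanged block, where the counter is 0.
data State : Set where
  idle low high both : ℕ → State
  low* high*         : State

variable
  s t                                  : State
  b c d e i k m n                      : ℕ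
  p                                    : Bool
  u v w u′ v′ w′ x₁ x₂ x₃ y₂ y₃ z₁ z₂ : List Bool
  q q₁ r r₁                            : List ℕ
  T T′ T₁ T₂                           : List (List Bool × List ℕ)
  f g                                  : ℕ → List Bool
  j x z                                : ℤ
  xs ys zs ws                          : List ℤ

-- The Boolean index tells whether the word is preceded by a one.
data Chain : Bool → ℕ → List Bool → Set where
  []  : ∀ {p} → Chain p 0 []
  off : ∀ {p n w} → Chain false n w → Chain p (suc n) (O ∷ w)
  on  : ∀ {n w} → Chain true n w → Chain false (suc n) (I ∷ w)

-- A block may end only in these states. `low 0` is missing since its counter is -1, `high*` since
-- an interchanged block has odd length.
data Close : State → ℕ → Set where
  idle : Close (idle c) c
  low  : Close (low (suc c)) c
  high : Close (high c) c
  both : Close (both c) c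
  low* : Close low* 0

-- Whether a block is interchanged depends on its parity, which is known only at its end: low₀ and flip₀
-- guess, and Close rejects a wrong guess.
data Run : State → (u v u′ v′ : List Bool) → ℕ → Set where
  nil   : Close s c → Run s [] [] [] [] c
  none  : Close s c → Run (idle c) u v u′ v′ e → Run s (O ∷ u) (O ∷ v) (O ∷ u′) (O ∷ v′) e
  low₀  : Run (low c) u v u′ v′ e → Run (idle c) (I ∷ u) (O ∷ v) (I ∷ u′) (O ∷ v′) e
  low₁  : Run (low c) u v u′ v′ e → Run (high c) (I ∷ u) (O ∷ v) (I ∷ u′) (O ∷ v′) e
  high₀ : Run (high (suc c)) u v u′ v′ e → Run (idle c) (O ∷ u) (I ∷ v) (O ∷ u′) (I ∷ v′) e
  high₁ : Run (high c) u v u′ v′ e → Run (low c) (O ∷ u) (I ∷ v) (O ∷ u′) (I ∷ v′) e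
  both  : Run (both c) u v u′ v′ e → Run (idle c) (I ∷ u) (I ∷ v) (I ∷ u′) (I ∷ v′) e
  flip₀ : Run low* u v u′ v′ e → Run (idle 0) (I ∷ u) (O ∷ v) (O ∷ u′) (I ∷ v′) e
  flip₁ : Run low* u v u′ v′ e → Run high* (I ∷ u) (O ∷ v) (O ∷ u′) (I ∷ v′) e
  flip₂ : Run high* u v u′ v′ e → Run low* (O ∷ u) (I ∷ v) (I ∷ u′) (O ∷ v′) e

-- Dyck d bot top e: if the excess of top over bot was d - 1 before, it is e at the end, and it is never
-- below -1, nor equal to -1 unless top has the next letter. For d = 1 this is the column condition.
data Dyck : ℕ → (bot top : List Bool) → ℕ → Set where
  nil  : Dyck (suc d) [] [] d
  none : Dyck (suc d) u v e → Dyck (suc d) (O ∷ u) (O ∷ v) e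
  bot  : Dyck d u v e → Dyck (suc d) (I ∷ u) (O ∷ v) e
  top  : Dyck (suc d) u v e → Dyck d (O ∷ u) (I ∷ v) e
  both : Dyck d u v e → Dyck d (I ∷ u) (I ∷ v) e

-- Reversal of runs and Dyck pairs.

-- What must be known about the reversed words already read, for the rest of a run from the given state
-- to be reversed in front of them. The roles are exchanged: v′ is read as the row and u′ as the factor.
Acc : State → (u v u′ v′ : List Bool) → ℕ → Set
Acc (idle c) u v u′ v′ e = ∀ {t} → Close t c → Run t u v u′ v′ e
Acc (low c)  u v u′ v′ e = Run (low c) u v u′ v′ e × (∀ {d} → c ≡ suc d → Run (idle d) u v u′ v′ e)
Acc (high c) u v u′ v′ e = Run (high c) u v u′ v′ e × Run (idle c) u v u′ v′ e
Acc (both c) u v u′ v′ e = Run (idle c) u v u′ v′ e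
Acc low*     u v u′ v′ e = Run (idle 0) u v u′ v′ e × Run high* u v u′ v′ e
Acc high*    u v u′ v′ e = Run low* u v u′ v′ e

acc-close : Close s c → Acc s u v u′ v′ e → Run (idle c) u v u′ v′ e
acc-close idle r       = r idle
acc-close low  (_ , r) = r refl
acc-close high (_ , r) = r
acc-close both r       = r
acc-close low* (r , _) = r

run-ʳ++ : ∀ {u v u′ v′ w x w′ x′} → Run s u v u′ v′ e → Acc s w x w′ x′ d →
          Run (idle e) (v′ ʳ++ w) (u′ ʳ++ x) (v ʳ++ w′) (u ʳ++ x′) d
run-ʳ++ (nil cl)    a       = acc-close cl a
run-ʳ++ (none cl r) a       = run-ʳ++ r (λ cl′ → none cl′ (acc-close cl a))
run-ʳ++ (low₀ r)    a       = run-ʳ++ r (high₁ (a high) , λ where refl → high₀ (a high))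
run-ʳ++ (low₁ r)    (a , _) = run-ʳ++ r (high₁ a , λ where refl → high₀ a)
run-ʳ++ (high₀ r)   a       = run-ʳ++ r (low₁ (a low) , low₀ (a low))
run-ʳ++ (high₁ r)   (a , _) = run-ʳ++ r (low₁ a , low₀ a)
run-ʳ++ (both r)    a       = run-ʳ++ r (both (a both))
run-ʳ++ (flip₀ r)   a       = run-ʳ++ r (flip₀ (a low*) , flip₁ (a low*))
run-ʳ++ (flip₁ r)   a       = run-ʳ++ r (flip₀ a , flip₁ a)
run-ʳ++ (flip₂ r)   (_ , a) = run-ʳ++ r (flip₂ a)

-- The counter takes the same values in both directions. After the interchange all unmatched blocks
-- have one more letter of `v′`; from the right, the initial counter `e` pays for those left alone,
-- and the ones met at counter 0 are interchanged back.
run-reverse : Run (idle c) u v u′ v′ e → Run (idle e) (reverse v′) (reverse u′) (reverse v) (reverse u) c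
run-reverse r = run-ʳ++ r nil

dyck-ʳ++ : ∀ {u v w x} → Dyck d u v e → Dyck d w x c → Dyck (suc e) (v ʳ++ w) (u ʳ++ x) c
dyck-ʳ++ nil      a = a
dyck-ʳ++ (none r) a = dyck-ʳ++ r (none a)
dyck-ʳ++ (bot r)  a = dyck-ʳ++ r (top a)
dyck-ʳ++ (top r)  a = dyck-ʳ++ r (bot a)
dyck-ʳ++ (both r) a = dyck-ʳ++ r (both a)

dyck-reverse : Dyck (suc d) u v e → Dyck (suc e) (reverse v) (reverse u) d
dyck-reverse r = dyck-ʳ++ r nil

-- Propagation of the column condition.

-- For runs (x₂, x₃) to (y₂, y₃) with counter b and (x₁, y₂) to (z₁, z₂) with counter c, put e = X₂ - Z₂,
-- a difference of prefix counts. Then x₂ exceeds x₁ by c + e and y₃ exceeds z₂ by b + e; these are the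
-- outer indices, shifted by 1. The constructors are named after the states of the two runs and list the
-- values that can occur; a prime marks an exceptional value of e next to the generic case.
data Coupled : ℕ → State → State → ℕ → Set where
  i-i   : ∀ b c e → Coupled (suc (c + e)) (idle b) (idle c) (suc (b + e))
  h-i   : ∀ b c e → Coupled (suc (c + e)) (high b) (idle c) (suc (b + e))
  h*-h  : ∀ c e → Coupled (suc (c + e)) high* (high c) (suc e)
  h*-h′ : ∀ c → Coupled (suc c) high* (high (suc c)) 0
  h*-h* : ∀ e → Coupled (suc e) high* high* (suc e)
  l*-i  : ∀ c e → Coupled (suc (c + e)) low* (idle c) (suc e)
  l-h   : ∀ b c e → Coupled (suc (c + e)) (low b) (high c) (b + e)
  l-h*′ : ∀ e → Coupled (suc (suc e)) (low 0) high* (suc e)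
  l-h*  : ∀ b e → Coupled (suc e) (low (suc b)) high* (suc (b + e))
  b-h   : ∀ b c e → Coupled (suc (c + e)) (both b) (high c) (suc (b + e))
  b-h*  : ∀ b e → Coupled (suc e) (both b) high* (suc (b + e))
  i-l*  : ∀ b e → Coupled e (idle b) low* (b + e)
  i-l   : ∀ b c e → Coupled (c + e) (idle b) (low c) (suc (b + e))
  h-l*  : ∀ b e → Coupled (suc e) (high b) low* (suc (b + e))
  h-l*′ : ∀ b → Coupled 0 (high (suc b)) low* (suc b)
  h-l   : ∀ b c e → Coupled (c + e) (high b) (low c) (suc (b + e))
  h*-b  : ∀ c e → Coupled (c + e) high* (both c) e
  l*-l* : ∀ e → Coupled (suc e) low* low* (suc e)
  l*-l′ : ∀ e → Coupled (suc e) low* (low 0) (suc (suc e))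
  l*-l  : ∀ c e → Coupled (suc (c + e)) low* (low (suc c)) (suc e)
  l-b   : ∀ b c e → Coupled (suc (c + e)) (low b) (both c) (b + e)
  b-b   : ∀ b c e → Coupled (suc (c + e)) (both b) (both c) (suc (b + e))

Dominates : ℕ → (z y : List Bool) (a b c : ℕ) → Set
Dominates d z y a b c = ∃[ e ] a ≡ c + e × Dyck d z y (b + e)

letter : ∀ {a b c d d′ z z′ y y′} → (∀ {e} → Dyck d z y e → Dyck d′ z′ y′ e) →
         Dominates d z y a b c → Dominates d′ z′ y′ a b c
letter f (e , eq , r) = e , eq , f r

stuck₁ : ∀ {a} → Run (low 0) x₂ x₃ y₂ y₃ b → Run high* x₁ y₂ z₁ z₂ c → Dyck 1 x₁ x₂ a → ⊥
stuck₂ : ∀ {a} → Run (high 0) x₂ x₃ y₂ y₃ b → Run low* x₁ y₂ z₁ z₂ c → Dyck 0 x₁ x₂ a → ⊥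
stuck₁ (high₁ B) (flip₁ C) (bot A) = stuck₂ B C A
stuck₂ (low₁ B) (flip₂ C) (top A) = stuck₁ B C A

-- Induction on the words, one position at a time. The difference X₂ - Z₂ rises when only `x₂` has
-- the letter and falls when only `z₂` has it; case splits on `e` or a counter select the
-- constructor for the new values.
joint : ∀ {a d f} → Coupled f s t d → Run s x₂ x₃ y₂ y₃ b → Run t x₁ y₂ z₁ z₂ c → Dyck f x₁ x₂ a →
        Dominates d z₂ y₃ a b c
joint (i-i b c e) (nil idle) (nil idle) nil = e , refl , nil
joint (i-i b c e) (none idle B) (none idle C) (none A) = letter none (joint (i-i b c e) B C A)
joint (i-i b c e) (none idle B) (low₀ C) (bot A) = letter none (joint (i-l b c e) B C A)
joint (i-i b c e) (none idle B) (flip₀ C) (bot A) = letter bot (joint (i-l* b e) B C A)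
joint (i-i b c e) (high₀ B) (none idle C) (none A) = letter top (joint (h-i (suc b) c e) B C A)
joint (i-i b c e) (high₀ B) (low₀ C) (bot A) = letter top (joint (h-l (suc b) c e) B C A)
-- Only `z₂` has a letter, so the difference drops from 0 to -1, the exceptional value of `h-l*′`.
joint (i-i b .0 zero) (high₀ B) (flip₀ C) (bot A) rewrite +-identityʳ b = letter both (joint (h-l*′ b) B C A)
joint (i-i b .0 (suc e)) (high₀ B) (flip₀ C) (bot A) rewrite +-suc b e = letter both (joint (h-l* (suc b) e) B C A)
joint (i-i b c e) (flip₀ B) (none idle C) (top A) rewrite sym (+-suc c e) = letter top (joint (l*-i c (suc e)) B C A)
joint (i-i b zero e) (flip₀ B) (low₀ C) (both A) = letter top (joint (l*-l′ e) B C A)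
joint (i-i b (suc c) e) (flip₀ B) (low₀ C) (both A) rewrite sym (+-suc c e) = letter top (joint (l*-l c (suc e)) B C A)
joint (i-i b c e) (flip₀ B) (flip₀ C) (both A) = letter both (joint (l*-l* e) B C A)
joint (i-i b c e) (low₀ B) (high₀ C) (top A) = letter bot (joint (l-h b (suc c) e) B C A)
joint (i-i b c e) (low₀ B) (both C) (both A) = letter bot (joint (l-b b c e) B C A)
joint (i-i b c e) (both B) (high₀ C) (top A) = letter both (joint (b-h b (suc c) e) B C A)
joint (i-i b c e) (both B) (both C) (both A) = letter both (joint (b-b b c e) B C A)
joint (h-i b c e) (nil high) (nil idle) nil = e , refl , nil
joint (h-i b c e) (none high B) (none idle C) (none A) = letter none (joint (i-i b c e) B C A)
joint (h-i b c e) (none high B) (low₀ C) (bot A) = letter none (joint (i-l b c e) B C A)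
joint (h-i b c e) (none high B) (flip₀ C) (bot A) = letter bot (joint (i-l* b e) B C A)
joint (h-i b c e) (low₁ B) (high₀ C) (top A) = letter bot (joint (l-h b (suc c) e) B C A)
joint (h-i b c e) (low₁ B) (both C) (both A) = letter bot (joint (l-b b c e) B C A)
joint (h*-h c e) (flip₁ B) (none high C) (top A) rewrite sym (+-suc c e) = letter top (joint (l*-i c (suc e)) B C A)
joint (h*-h zero e) (flip₁ B) (low₁ C) (both A) = letter top (joint (l*-l′ e) B C A)
joint (h*-h (suc c) e) (flip₁ B) (low₁ C) (both A) rewrite sym (+-suc c e) = letter top (joint (l*-l c (suc e)) B C A)
joint (h*-h′ c) (flip₁ B) (none high C) (top A) =
  letter top (joint (l*-i (suc c) 0) B C (subst (λ i → Dyck (suc (suc i)) _ _ _) (sym (+-identityʳ c)) A))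
joint (h*-h′ c) (flip₁ B) (low₁ C) (both A) =
  letter top (joint (l*-l c 0) B C (subst (λ i → Dyck (suc i) _ _ _) (sym (+-identityʳ c)) A))
joint (h*-h* e) (flip₁ B) (flip₁ C) (both A) = letter both (joint (l*-l* e) B C A)
joint (l*-i c e) (nil low*) (nil idle) nil = e , refl , nil
joint (l*-i c e) (none low* B) (none idle C) (none A) = letter none (joint (i-i 0 c e) B C A)
joint (l*-i c e) (none low* B) (low₀ C) (bot A) = letter none (joint (i-l 0 c e) B C A)
joint (l*-i c e) (none low* B) (flip₀ C) (bot A) = letter bot (joint (i-l* 0 e) B C A)
joint (l*-i c zero) (flip₂ B) (high₀ C) (none A) rewrite +-identityʳ c = letter bot (joint (h*-h′ c) B C A)
joint (l*-i c (suc e)) (flip₂ B) (high₀ C) (none A) rewrite +-suc c e = letter bot (joint (h*-h (suc c) e) B C A)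
joint (l*-i c e) (flip₂ B) (both C) (bot A) = letter bot (joint (h*-b c e) B C A)
joint (l-h _ c e) (nil low) (nil high) nil = e , refl , nil
joint (l-h (suc b) c e) (none low B) (none high C) (none A) = letter none (joint (i-i b c e) B C A)
joint (l-h (suc b) c e) (none low B) (low₁ C) (bot A) = letter none (joint (i-l b c e) B C A)
joint (l-h b c e) (high₁ B) (none high C) (none A) = letter top (joint (h-i b c e) B C A)
joint (l-h b c e) (high₁ B) (low₁ C) (bot A) = letter top (joint (h-l b c e) B C A)
joint (l-h*′ e) (high₁ B) (flip₁ C) (bot A) = letter both (joint (h-l* 0 e) B C A)
joint (l-h* b e) (none low B) (flip₁ C) (bot A) = letter bot (joint (i-l* b e) B C A)
joint (l-h* b zero) (high₁ B) (flip₁ C) (bot A) rewrite +-identityʳ b = letter both (joint (h-l*′ b) B C A)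
joint (l-h* b (suc e)) (high₁ B) (flip₁ C) (bot A) rewrite +-suc b e = letter both (joint (h-l* (suc b) e) B C A)
joint (b-h b c e) (nil both) (nil high) nil = e , refl , nil
joint (b-h b c e) (none both B) (none high C) (none A) = letter none (joint (i-i b c e) B C A)
joint (b-h b c e) (none both B) (low₁ C) (bot A) = letter none (joint (i-l b c e) B C A)
joint (b-h* b e) (none both B) (flip₁ C) (bot A) = letter bot (joint (i-l* b e) B C A)
joint (i-l* b (suc e)) (nil idle) (nil low*) nil rewrite +-suc b e = e , refl , nil
joint (i-l* b (suc e)) (none idle B) (none low* C) (none A) rewrite +-suc b e = letter none (joint (i-i b 0 e) B C A)
joint (i-l* b (suc e)) (high₀ B) (none low* C) (none A) rewrite +-suc b e = letter top (joint (h-i (suc b) 0 e) B C A)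
joint (i-l* b e) (flip₀ B) (none low* C) (top A) = letter top (joint (l*-i 0 e) B C A)
-- The difference is -1 and both counters are 0. No constructor of `Coupled` fits the states after
-- this letter.
joint (i-l* zero zero) (low₀ B) (flip₂ C) (top A) with () ← stuck₁ B C A
joint (i-l* zero (suc e)) (low₀ B) (flip₂ C) (top A) = letter none (joint (l-h*′ e) B C A)
joint (i-l* (suc b) e) (low₀ B) (flip₂ C) (top A) = letter none (joint (l-h* b e) B C A)
joint (i-l* b e) (both B) (flip₂ C) (top A) = letter top (joint (b-h* b e) B C A)
joint (i-l b (suc c) e) (nil idle) (nil low) nil = e , refl , nil
joint (i-l b (suc c) e) (none idle B) (none low C) (none A) = letter none (joint (i-i b c e) B C A)
joint (i-l b (suc c) e) (high₀ B) (none low C) (none A) = letter top (joint (h-i (suc b) c e) B C A)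
joint (i-l b (suc c) e) (flip₀ B) (none low C) (top A) rewrite sym (+-suc c e) = letter top (joint (l*-i c (suc e)) B C A)
joint (i-l b c e) (low₀ B) (high₁ C) (top A) = letter bot (joint (l-h b c e) B C A)
joint (i-l b c e) (both B) (high₁ C) (top A) = letter both (joint (b-h b c e) B C A)
joint (h-l* b e) (nil high) (nil low*) nil = e , refl , nil
joint (h-l* b e) (none high B) (none low* C) (none A) = letter none (joint (i-i b 0 e) B C A)
joint (h-l* zero e) (low₁ B) (flip₂ C) (top A) = letter none (joint (l-h*′ e) B C A)
joint (h-l* (suc b) e) (low₁ B) (flip₂ C) (top A) rewrite sym (+-suc b e) = letter none (joint (l-h* b (suc e)) B C A)
joint (h-l*′ b) (low₁ B) (flip₂ C) (top A) =
  letter (λ D → none (subst (λ i → Dyck (suc i) _ _ _) (+-identityʳ b) D)) (joint (l-h* b 0) B C A)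
joint (h-l b (suc c) e) (nil high) (nil low) nil = e , refl , nil
joint (h-l b (suc c) e) (none high B) (none low C) (none A) = letter none (joint (i-i b c e) B C A)
joint (h-l b c e) (low₁ B) (high₁ C) (top A) = letter bot (joint (l-h b c e) B C A)
joint (h*-b c e) (flip₁ B) (none both C) (top A) = letter top (joint (l*-i c e) B C A)
joint (l*-l* e) (nil low*) (nil low*) nil = e , refl , nil
joint (l*-l* e) (none low* B) (none low* C) (none A) = letter none (joint (i-i 0 0 e) B C A)
joint (l*-l* e) (flip₂ B) (flip₂ C) (none A) = letter none (joint (h*-h* e) B C A)
joint (l*-l′ e) (flip₂ B) (high₁ C) (none A) = letter bot (joint (h*-h 0 e) B C A)
joint (l*-l c e) (nil low*) (nil low) nil = e , refl , nil
joint (l*-l c e) (none low* B) (none low C) (none A) = letter none (joint (i-i 0 c e) B C A)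
joint (l*-l c zero) (flip₂ B) (high₁ C) (none A) rewrite +-identityʳ c = letter bot (joint (h*-h′ c) B C A)
joint (l*-l c (suc e)) (flip₂ B) (high₁ C) (none A) rewrite +-suc c e = letter bot (joint (h*-h (suc c) e) B C A)
joint (l-b (suc b) c e) (nil low) (nil both) nil = e , refl , nil
joint (l-b (suc b) c e) (none low B) (none both C) (none A) = letter none (joint (i-i b c e) B C A)
joint (l-b b c e) (high₁ B) (none both C) (none A) = letter top (joint (h-i b c e) B C A)
joint (b-b b c e) (nil both) (nil both) nil = e , refl , nil
joint (b-b b c e) (none both B) (none both C) (none A) = letter none (joint (i-i b c e) B C A)

-- Totality, uniqueness and counting for runs

Out : State → List Bool → List Bool → Set
Out s u v = ∃[ u′ ] ∃[ v′ ] ∃[ e ] Run s u v u′ v′ e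

extend : ∀ {s t u v u₁ v₁ p q} → (∀ {u′ v′ e} → Run s u v u′ v′ e → Run t u₁ v₁ (p ∷ u′) (q ∷ v′) e) →
      Out s u v → Out t u₁ v₁
extend f (_ , _ , _ , r) = _ , _ , _ , f r

run-idle  : ∀ c → Chain false n u → Chain false n v → Out (idle c) u v
run-low   : ∀ c → Chain true n u → Chain false n v → Out (low (suc c)) u v
run-high  : ∀ c → Chain false n u → Chain true n v → Out (high (suc c)) u v
run-both  : ∀ c → Chain true n u → Chain true n v → Out (both c) u v
-- At counter 0 the parity of the block decides, so the recursion reports which of the two guesses
-- survives the end of the block.
run-low*  : Chain true n u → Chain false n v → Out (low 0) u v ⊎ Out low* u v
run-high* : Chain false n u → Chain true n v → Out (high 0) u v ⊎ Out high* u v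

run-idle c [] [] = _ , _ , _ , nil idle
run-idle c (off α) (off β) = extend (none idle) (run-idle c α β)
run-idle c (off α) (on β) = extend high₀ (run-high c α β)
run-idle zero (on α) (off β) = Sum.[ extend low₀ , extend flip₀ ] (run-low* α β)
run-idle (suc c) (on α) (off β) = extend low₀ (run-low c α β)
run-idle c (on α) (on β) = extend both (run-both c α β)
run-low c [] [] = _ , _ , _ , nil low
run-low c (off α) (off β) = extend (none low) (run-idle c α β)
run-low c (off α) (on β) = extend high₁ (run-high c α β)
run-high c [] [] = _ , _ , _ , nil high
run-high c (off α) (off β) = extend (none high) (run-idle (suc c) α β)
run-high c (on α) (off β) = extend low₁ (run-low c α β)
run-both c [] [] = _ , _ , _ , nil both
run-both c (off α) (off β) = extend (none both) (run-idle c α β)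
run-low* [] [] = inj₂ (_ , _ , _ , nil low*)
run-low* (off α) (off β) = inj₂ (extend (none low*) (run-idle 0 α β))
run-low* (off α) (on β) = Sum.map (extend high₁) (extend flip₂) (run-high* α β)
run-high* [] [] = inj₁ (_ , _ , _ , nil high)
run-high* (off α) (off β) = inj₁ (extend (none high) (run-idle 0 α β))
run-high* (on α) (off β) = Sum.map (extend low₁) (extend flip₁) (run-low* α β)

close-unique : Close s c → Close s d → c ≡ d
close-unique idle idle = refl
close-unique low low = refl
close-unique high high = refl
close-unique both both = refl
close-unique low* low* = refl

-- The guess `low 0` can close only after a letter of `v`, the guess `low*` only after a letter of
-- `u`, and both read the same block.
low-exclusive  : ∀ {u₁ v₁ u₂ v₂} → Run (low 0) u v u₁ v₁ d → Run low* u v u₂ v₂ e → ⊥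
high-exclusive : ∀ {u₁ v₁ u₂ v₂} → Run (high 0) u v u₁ v₁ d → Run high* u v u₂ v₂ e → ⊥
low-exclusive (high₁ r) (flip₂ r′) = high-exclusive r r′
high-exclusive (low₁ r) (flip₁ r′) = low-exclusive r r′

run-unique : ∀ {u₁ v₁ u₂ v₂} → Run s u v u₁ v₁ d → Run s u v u₂ v₂ e → u₁ ≡ u₂ × v₁ ≡ v₂ × d ≡ e
run-unique (nil x) (nil y) = refl , refl , close-unique x y
run-unique (none x r) (none y r′) with refl ← close-unique x y
  with refl , refl , refl ← run-unique r r′ = refl , refl , refl
run-unique (low₀ r) (low₀ r′) with refl , refl , refl ← run-unique r r′ = refl , refl , refl
run-unique (low₀ r) (flip₀ r′) = ⊥-elim (low-exclusive r r′)
run-unique (low₁ r) (low₁ r′) with refl , refl , refl ← run-unique r r′ = refl , refl , refl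
run-unique (high₀ r) (high₀ r′) with refl , refl , refl ← run-unique r r′ = refl , refl , refl
run-unique (high₁ r) (high₁ r′) with refl , refl , refl ← run-unique r r′ = refl , refl , refl
run-unique (both r) (both r′) with refl , refl , refl ← run-unique r r′ = refl , refl , refl
run-unique (flip₀ r) (low₀ r′) = ⊥-elim (low-exclusive r′ r)
run-unique (flip₀ r) (flip₀ r′) with refl , refl , refl ← run-unique r r′ = refl , refl , refl
run-unique (flip₁ r) (flip₁ r′) with refl , refl , refl ← run-unique r r′ = refl , refl , refl
run-unique (flip₂ r) (flip₂ r′) with refl , refl , refl ← run-unique r r′ = refl , refl , refl

weaken : Chain true n w → Chain p n w
weaken [] = []
weaken (off α) = off α

-- These refer to the output words: in an interchanged block a letter of `u` is written into `v′`,
-- so `low*` counts as high and `high*` as low.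
lastLow lastHigh : State → Bool
lastLow (low _) = true
lastLow (both _) = true
lastLow high* = true
lastLow _ = false
lastHigh (high _) = true
lastHigh (both _) = true
lastHigh low* = true
lastHigh _ = false

run-chains : Run s u v u′ v′ e → Chain p n u → Chain (lastLow s) n u′ × Chain (lastHigh s) n v′
run-chains (nil _) [] = [] , []
run-chains (none _ r) (off α) with β , γ ← run-chains r α = off β , off γ
run-chains (low₀ r) (on α) with β , γ ← run-chains r α = on β , off γ
run-chains (low₁ r) (on α) with β , γ ← run-chains r α = on β , off γ
run-chains (high₀ r) (off α) with β , γ ← run-chains r α = off β , on γ
run-chains (high₁ r) (off α) with β , γ ← run-chains r α = off β , on γ
run-chains (both r) (on α) with β , γ ← run-chains r α = on β , on γ
run-chains (flip₀ r) (on α) with β , γ ← run-chains r α = off β , on γ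
run-chains (flip₁ r) (on α) with β , γ ← run-chains r α = off β , on γ
run-chains (flip₂ r) (off α) with β , γ ← run-chains r α = on β , off γ

-- The first letters of `u` and `v` become neighbours. If `u` may start with a one, `v` has to admit
-- a preceding one, whence `not p`.
chain-ʳ++ : Chain p m u → Chain (not p) n v → Chain false (m + n) (u ʳ++ v)
chain-ʳ++ {p = false} [] β = weaken β
chain-ʳ++ {p = true} [] β = β
chain-ʳ++ {p = false} {n = n} (off {n = m} α) β rewrite sym (+-suc m n) = chain-ʳ++ α (off (weaken β))
chain-ʳ++ {p = true} {n = n} (off {n = m} α) β rewrite sym (+-suc m n) = chain-ʳ++ α (off β)
chain-ʳ++ {n = n} (on {n = m} α) β rewrite sym (+-suc m n) = chain-ʳ++ α (on β)

chain-reverse : Chain false n w → Chain false n (reverse w)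
chain-reverse {n} α = subst (λ m → Chain false m _) (+-identityʳ n) (chain-ʳ++ α [])

weight : List Bool → ℕ
weight [] = 0
weight (O ∷ w) = weight w
weight (I ∷ w) = suc (weight w)

run-weight : Run s u v u′ v′ e → weight u + weight v ≡ weight u′ + weight v′
run-weight (nil _) = refl
run-weight (none _ r) = run-weight r
run-weight (low₀ r) = cong suc (run-weight r)
run-weight (low₁ r) = cong suc (run-weight r)
run-weight {u = _ ∷ u} {_ ∷ v} {_ ∷ u′} {_ ∷ v′} (high₀ r)
  rewrite +-suc (weight u) (weight v) | +-suc (weight u′) (weight v′) = cong suc (run-weight r)
run-weight {u = _ ∷ u} {_ ∷ v} {_ ∷ u′} {_ ∷ v′} (high₁ r)
  rewrite +-suc (weight u) (weight v) | +-suc (weight u′) (weight v′) = cong suc (run-weight r)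
run-weight {u = _ ∷ u} {_ ∷ v} {_ ∷ u′} {_ ∷ v′} (both r)
  rewrite +-suc (weight u) (weight v) | +-suc (weight u′) (weight v′) = cong (λ k → suc (suc k)) (run-weight r)
run-weight {u′ = _ ∷ u′} {_ ∷ v′} (flip₀ r) rewrite +-suc (weight u′) (weight v′) = cong suc (run-weight r)
run-weight {u′ = _ ∷ u′} {_ ∷ v′} (flip₁ r) rewrite +-suc (weight u′) (weight v′) = cong suc (run-weight r)
run-weight {u = _ ∷ u} {_ ∷ v} (flip₂ r) rewrite +-suc (weight u) (weight v) = cong suc (run-weight r)

Balance : State → (k l : ℕ) → Set
Balance (idle c) k l = c + k ≡ l
Balance (low c) k l = c + k ≡ suc l
Balance (high c) k l = c + k ≡ l
Balance (both c) k l = c + k ≡ l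
Balance low* k l = k ≡ l
Balance high* k l = k ≡ l

close-balance : ∀ {k l} → Close s c → c + k ≡ l → Balance s k l
close-balance idle eq = eq
close-balance low eq = cong suc eq
close-balance high eq = eq
close-balance both eq = eq
close-balance low* eq = eq

run-balance : Run s u v u′ v′ e → Balance s (weight v) (e + weight u′)
run-balance (nil cl) = close-balance cl refl
run-balance (none cl r) = close-balance cl (run-balance r)
run-balance {u′ = _ ∷ u′} {e = e} (low₀ r) rewrite +-suc e (weight u′) = run-balance r
run-balance {u′ = _ ∷ u′} {e = e} (low₁ r) rewrite +-suc e (weight u′) = run-balance r
run-balance {v = _ ∷ v} (high₀ {c} r) rewrite +-suc c (weight v) = run-balance r
run-balance {v = _ ∷ v} (high₁ {c} r) rewrite +-suc c (weight v) = cong suc (run-balance r)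
run-balance {v = _ ∷ v} {u′ = _ ∷ u′} {e = e} (both {c} r)
  rewrite +-suc c (weight v) | +-suc e (weight u′) = cong suc (run-balance r)
run-balance (flip₀ r) = run-balance r
run-balance (flip₁ r) = run-balance r
run-balance {u′ = _ ∷ u′} {e = e} (flip₂ r) rewrite +-suc e (weight u′) = cong suc (run-balance r)

dyck-balance : Dyck d u v e → d + weight v ≡ suc (e + weight u)
dyck-balance (nil {d}) = refl
dyck-balance (none r) = dyck-balance r
dyck-balance {e = e} (bot {u = u} r) rewrite +-suc e (weight u) = cong suc (dyck-balance r)
dyck-balance {d} (top {v = v} r) rewrite +-suc d (weight v) = dyck-balance r
dyck-balance {d} {e = e} (both {u = u} {v} r) rewrite +-suc d (weight v) | +-suc e (weight u) = cong suc (dyck-balance r)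

-- Undoing a run.

-- Inside an interchanged block v′ may be one letter ahead of v.
ahead : State → ℕ
ahead low* = 1
ahead _ = 0

dyck-cast : ∀ {f} → d ≡ e → Dyck d u v f → Dyck e u v f
dyck-cast refl D = D

-- An interchanged block gives `v′` its letters earlier than `v`, and one more in total, so
-- replacing `v′` by `v` as the lower word only raises the excess. `k` counts the interchanged
-- blocks already read.
dyck-unrun : ∀ {f} k → Run s u v u′ v′ e → Dyck d v′ w f → ∃[ g ] f ≤ g × Dyck (d + (ahead s + k)) v w g
dyck-unrun {s = s} k (nil _) (nil {d}) = d + (ahead s + k) , m≤m+n d _ , nil
dyck-unrun {s = s} k (none {c = c} _ r) (none {d = d} D)
  with g , le , D′ ← dyck-unrun (ahead s + k) r D = g , le , none D′
dyck-unrun {s = s} k (none _ r) (top D) with g , le , D′ ← dyck-unrun (ahead s + k) r D = g , le , top D′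
dyck-unrun k (low₀ r) (none D) with g , le , D′ ← dyck-unrun k r D = g , le , none D′
dyck-unrun k (low₀ r) (top D) with g , le , D′ ← dyck-unrun k r D = g , le , top D′
dyck-unrun k (low₁ r) (none D) with g , le , D′ ← dyck-unrun k r D = g , le , none D′
dyck-unrun k (low₁ r) (top D) with g , le , D′ ← dyck-unrun k r D = g , le , top D′
dyck-unrun k (high₀ r) (bot D) with g , le , D′ ← dyck-unrun k r D = g , le , bot D′
dyck-unrun k (high₀ r) (both D) with g , le , D′ ← dyck-unrun k r D = g , le , both D′
dyck-unrun k (high₁ r) (bot D) with g , le , D′ ← dyck-unrun k r D = g , le , bot D′
dyck-unrun k (high₁ r) (both D) with g , le , D′ ← dyck-unrun k r D = g , le , both D′
dyck-unrun k (both r) (bot D) with g , le , D′ ← dyck-unrun k r D = g , le , bot D′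
dyck-unrun k (both r) (both D) with g , le , D′ ← dyck-unrun k r D = g , le , both D′
dyck-unrun k (flip₀ r) (bot {d} D)
  with g , le , D′ ← dyck-unrun k r D = g , le , none (dyck-cast (+-suc d k) D′)
dyck-unrun k (flip₀ r) (both {d} D) with g , le , D′ ← dyck-unrun k r D =
  g , le , top (dyck-cast (+-suc d k) D′)
dyck-unrun k (flip₁ r) (bot {d} D) 
  with g , le , D′ ← dyck-unrun k r D = g , le , none (dyck-cast (+-suc d k) D′)
dyck-unrun k (flip₁ r) (both {d} D) with g , le , D′ ← dyck-unrun k r D =
  g , le , top (dyck-cast (+-suc d k) D′)
dyck-unrun k (flip₂ r) (none {d} D) with g , le , D′ ← dyck-unrun k r D =
  g , le , bot (dyck-cast (sym (+-suc d k)) D′)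
dyck-unrun {d = d} k (flip₂ r) (top D) with g , le , D′ ← dyck-unrun k r D =
  g , le , both (dyck-cast (sym (+-suc d k)) D′)

-- A run whose final counter is at most the final excess of a Dyck pair has its counter at most that
-- excess all along; hence running backwards from a valid pair ends with counter 0.
Bound : State → ℕ → Set
Bound (idle c) d = c ≤ pred d
Bound (low c)  d = c ≤ d
Bound (high c) d = c ≤ pred d
Bound (both c) d = c ≤ pred d
Bound low*     d = ⊤
Bound high*    d = ⊤

close-bound : Close s c → c ≤ d → Bound s (suc d)
close-bound idle le = le
close-bound low  le = s≤s le
close-bound high le = le
close-bound both le = le
close-bound low* le = tt

run-bound : ∀ {f} → Run s u v u′ v′ e → Dyck d u′ v′ f → e ≤ f → Bound s d
run-bound (nil cl) nil le = close-bound cl le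
run-bound (none cl r) (none D) le = close-bound cl (run-bound r D le)
run-bound (low₀ r) (bot D) le = run-bound r D le
run-bound (low₁ r) (bot D) le = run-bound r D le
run-bound (high₀ r) (top D) le = pred-mono-≤ (run-bound r D le)
run-bound (high₁ r) (top D) le = run-bound r D le
run-bound (both r) (both D) le = run-bound r D le
run-bound (flip₀ r) (top D) le = z≤n
run-bound (flip₁ r) D le = tt
run-bound (flip₂ r) D le = tt

-- The inverse is the same rule on the reversed words with the roles exchanged, started at the
-- recorded counter `e`.
unrun : Chain false n u′ → Chain false n v′ → ∀ {f} → Dyck 1 u′ v′ f → e ≤ f →
        ∃[ u ] ∃[ v ] Chain false n u × Chain false n v × Run (idle 0) u v u′ v′ e
unrun {u′ = u′} {v′} {e = e} α β D le
  with v , u , c , r ← run-idle e (chain-reverse β) (chain-reverse α)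
  with γ , δ ← run-chains r (chain-reverse β)
  with r′ ← run-reverse r
  rewrite reverse-involutive u′ | reverse-involutive v′
  with z≤n ← run-bound r′ D le = _ , _ , chain-reverse δ , chain-reverse γ , r′

run-injective : ∀ {u₁ v₁ u₂ v₂} → Run (idle c) u₁ v₁ u v e → Run (idle d) u₂ v₂ u v e → u₁ ≡ u₂ × v₁ ≡ v₂
run-injective r r′ with eq , eq′ , _ ← run-unique (run-reverse r) (run-reverse r′) =
  reverse-injective eq′ , reverse-injective eq

dyck-run : ∀ {a} → Run (idle 0) x₂ x₃ y₂ y₃ b → Run (idle 0) x₁ y₂ z₁ z₂ c → Dyck 1 x₁ x₂ a →
           ∃[ e ] a ≡ c + e × Dyck 1 z₂ y₃ (b + e)
dyck-run = joint (i-i 0 0 0)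

run-dyck : Run (idle 0) x₂ x₃ y₂ y₃ b → Run (idle 0) x₁ y₂ z₁ z₂ c → Dyck 1 z₂ y₃ d → b ≤ d →
           ∃[ a ] Dyck 1 x₁ x₂ a
run-dyck {x₂ = x₂} {b = b} {x₁} {c = c} {d = d} B C D le
  -- Reversal also exchanges the order of the two runs. The invariant starts from the right end,
  -- where the difference is `d ∸ b`, and the vanishing final excess forces `zero`.
  with zero , refl , A ← joint (i-i c b (d ∸ b)) (run-reverse C) (run-reverse B)
                           (dyck-cast (cong suc (sym (m+[n∸m]≡n le))) (dyck-reverse D))
  with A′ ← dyck-reverse A rewrite reverse-involutive x₁ | reverse-involutive x₂ = _ , A′

-- Words without ones: missing rows and empty factors.

zeros : ℕ → List Bool
zeros n = replicate n O

chain-zeros : ∀ n → Chain p n (zeros n)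
chain-zeros zero = []
chain-zeros (suc n) = off (chain-zeros n)

weight-zeros : ∀ n → weight (zeros n) ≡ 0
weight-zeros zero = refl
weight-zeros (suc n) = weight-zeros n

weight≡0 : Chain p n w → weight w ≡ 0 → w ≡ zeros n
weight≡0 [] eq = refl
weight≡0 (off α) eq = cong (O ∷_) (weight≡0 α eq)

dyck-zeros : Chain p n w → Dyck (suc d) (zeros n) w (d + weight w)
dyck-zeros {d = d} [] = subst (Dyck _ _ _) (sym (+-identityʳ d)) nil
dyck-zeros (off α) = none (dyck-zeros α)
dyck-zeros {d = d} (on {w = w} α) = top (subst (Dyck _ _ _) (sym (+-suc d (weight w))) (dyck-zeros α))

-- With a missing row treated as a row of zeros, the creation of a row becomes a case of the general
-- run: every letter of `w` is an unmatched block of `v` and stays.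
run-zeros  : Chain false n w → Run (idle c) (zeros n) w (zeros n) w (c + weight w)
run-zeros′ : Chain true n w → Run (high c) (zeros n) w (zeros n) w (c + weight w)
run-zeros {c = c} [] = subst (Run _ _ _ _ _) (sym (+-identityʳ c)) (nil idle)
run-zeros (off α) = none idle (run-zeros α)
run-zeros {c = c} (on {w = w} α) = high₀ (subst (Run _ _ _ _ _) (sym (+-suc c (weight w))) (run-zeros′ α))
run-zeros′ {c = c} [] = subst (Run _ _ _ _ _) (sym (+-identityʳ c)) (nil high)
run-zeros′ (off α) = none high (run-zeros α)

-- Against an empty factor each letter of the row is an unmatched block by itself; interchanging
-- them all hands the row back and sends nothing down.
run-empty  : Chain false n w → Run (idle 0) w (zeros n) (zeros n) w 0
run-empty′ : Chain true n w → Run low* w (zeros n) (zeros n) w 0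
run-empty [] = nil idle
run-empty (off α) = none idle (run-empty α)
run-empty (on α) = flip₀ (run-empty′ α)
run-empty′ [] = nil low*
run-empty′ (off α) = none low* (run-empty α)

-- Recording rows

column-[] : ∀ q → Columnwise _<_ q []
column-[] q = subst (All _) (sym (zipWith-zeroʳ _ q)) []

-- The length bound puts each `i` appended to the lower row beneath an old entry of the upper row,
-- which is smaller than `i`.
column-++ : All (_< i) q → Columnwise _<_ q r → length r + e ≤ length q →
            Columnwise _<_ (q ++ replicate d i) (r ++ replicate e i)
column-++ {i} {[]} {[]} {zero} {d} lt C le = column-[] (replicate d i)
column-++ {i} {x ∷ q} {[]} {zero} {d} lt C le = column-[] ((x ∷ q) ++ replicate d i)
column-++ {q = x ∷ q} {r = []} {e = suc e} (x<i ∷ lt) C le = x<i ∷ column-++ {q = q} {r = []} lt (column-[] q) (s≤s⁻¹ le)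
column-++ {q = x ∷ q} {r = y ∷ r} (_ ∷ lt) (x<y ∷ C) le = x<y ∷ column-++ lt C (s≤s⁻¹ le)

column-prefix : ∀ q r → Columnwise _<_ (q ++ q₁) (r ++ r₁) → Columnwise _<_ q r
column-prefix [] r C = []
column-prefix (x ∷ q) [] C = []
column-prefix (x ∷ q) (y ∷ r) (x<y ∷ C) = x<y ∷ column-prefix q r C

-- An entry beneath one of the appended `i` would exceed `i`, the largest value allowed.
column-length : ∀ q → Columnwise _<_ (q ++ replicate e i) r → All (_< suc i) r → length r ≤ length q + e →
                length r ≤ length q
column-length {r = []} q C lt le = z≤n
column-length {e = suc e} {r = y ∷ r} [] (i<y ∷ _) (y≤i ∷ _) le = contradiction i<y (<⇒≱ y≤i)
column-length {r = y ∷ r} (x ∷ q) (_ ∷ C) (_ ∷ lt) le = s≤s (column-length q C lt (s≤s⁻¹ le))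

weak-++ : Linked _≤_ q → All (_< i) q → Linked _≤_ (q ++ replicate e i)
weak-++ {e = zero} [] [] = []
weak-++ {e = suc zero} [] [] = [-]
weak-++ {e = suc (suc e)} [] [] = ≤-refl ∷ weak-++ {e = suc e} [] []
weak-++ {e = zero} [-] (x ∷ []) = [-]
weak-++ {e = suc e} [-] (x ∷ []) = <⇒≤ x ∷ weak-++ {e = suc e} [] []
weak-++ (x≤y ∷ L) (_ ∷ lt) = x≤y ∷ weak-++ L lt

weak-constant : Linked _≤_ (i ∷ q) → All (_< suc i) q → q ≡ replicate (length q) i
weak-constant [-] [] = refl
weak-constant (i≤x ∷ L) (x≤i ∷ lt) with refl ← ≤-antisym i≤x (s≤s⁻¹ x≤i) = cong (_ ∷_) (weak-constant L lt)

weak-prefix : ∀ q → Linked _≤_ (q ++ r) → Linked _≤_ q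
weak-prefix [] L = []
weak-prefix (x ∷ []) L = [-]
weak-prefix (x ∷ y ∷ q) (x≤y ∷ L) = x≤y ∷ weak-prefix (y ∷ q) L

weak-split : Linked _≤_ q → All (_< suc i) q → ∃[ r ] ∃[ e ] q ≡ r ++ replicate e i × All (_< i) r
weak-split {q = []} L [] = [] , 0 , refl , []
weak-split {q = x ∷ q} {i} L (x≤i ∷ lt) with x ≟ i
... | yes refl = [] , suc (length q) , cong (x ∷_) (weak-constant L lt) , []
... | no x≢i with r , e , refl , lt′ ← weak-split (Linked.tail L) lt = x ∷ r , e , refl , ≤∧≢⇒< (s≤s⁻¹ x≤i) x≢i ∷ lt′

split-unique : All (_< i) q → All (_< i) r → q ++ replicate d i ≡ r ++ replicate e i → q ≡ r × d ≡ e
split-unique {d = d} {e} [] [] eq = refl , trans (sym (length-replicate d)) (trans (cong length eq) (length-replicate e))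
split-unique {d = suc d} [] (y<i ∷ _) eq = contradiction y<i (<-irrefl (sym (∷-injectiveˡ eq)))
split-unique {e = suc e} (x<i ∷ _) [] eq = contradiction x<i (<-irrefl (∷-injectiveˡ eq))
split-unique (x<i ∷ lt) (_ ∷ lt′) eq with refl , eq′ ← ∷-injective eq
  with refl , refl ← split-unique lt lt′ eq′ = refl , refl

all-replicate : ∀ e → All (_< suc i) (replicate e i)
all-replicate zero = []
all-replicate (suc e) = ≤-refl ∷ all-replicate e

-- Insertion into a tableau

-- A row of P, as a word, together with the corresponding row of Q.
Cell : Set
Cell = List Bool × List ℕ

-- `n` is the common length of all words; `i` stands for the number of factors inserted so far.
record Filled (n i : ℕ) (cell : Cell) : Set where
  constructor filled
  field
    chain   : Chain false n (proj₁ cell)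
    size    : length (proj₂ cell) ≡ weight (proj₁ cell)
    nonzero : proj₂ cell ≢ []
    weak    : Linked _≤_ (proj₂ cell)
    small   : All (_< i) (proj₂ cell)

Adjacent : Cell → Cell → Set
Adjacent (u , q) (v , r) = (∃[ e ] Dyck 1 v u e) × Columnwise _<_ q r

record Valid (n i : ℕ) (T : List Cell) : Set where
  constructor valid
  field
    cells : All (Filled n i) T
    links : Linked Adjacent T

-- The final counter of a run is the number of letters the row gains, hence the number of entries
-- recorded there. `stop` is separated from `grow` so that no empty row arises.
data Insert (i : ℕ) : List Cell → List Bool → List Cell → Set where
  stop : weight v ≡ 0 → Insert i [] v []
  grow : weight v ≢ 0 → Insert i [] v ((v , replicate (weight v) i) ∷ [])
  step : Run (idle 0) u v u′ v′ e → Insert i T u′ T′ →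
         Insert i ((u , q) ∷ T) v ((v′ , q ++ replicate e i) ∷ T′)

insert : All (Filled n k) T → Chain false n v → ∃[ T′ ] Insert i T v T′
insert {v = v} [] β with weight v ≟ 0
... | yes eq = _ , stop eq
... | no ne = _ , grow ne
insert (filled α _ _ _ _ ∷ fs) β with _ , _ , _ , r ← run-idle 0 α β
  with T′ , ins ← insert fs (proj₁ (run-chains r α)) = _ , step r ins

insert-unique : Insert i T v T₁ → Insert i T v T₂ → T₁ ≡ T₂
insert-unique (stop _) (stop _) = refl
insert-unique (stop eq) (grow ne) = contradiction eq ne
insert-unique (grow ne) (stop eq) = contradiction eq ne
insert-unique (grow _) (grow _) = refl
insert-unique (step r ins) (step r′ ins′) with refl , refl , refl ← run-unique r r′
  with refl ← insert-unique ins ins′ = refl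

constant-small : ∀ d → All (_< i) q → replicate d i ≡ q ++ replicate e i → q ≡ []
constant-small d lt eq = sym (proj₁ (split-unique [] lt eq))

-- Old entries are smaller than `i`, so the appended copies are recognizable; they give `e` and tell
-- a new row from an enlarged one. The lower rows are compared before the run is undone, because the
-- word they received is one of its outputs.
insert-injective : All (Filled n i) T₁ → All (Filled n i) T₂ → Chain false n u → Chain false n v →
                   Insert i T₁ u T → Insert i T₂ v T′ → T ≡ T′ → T₁ ≡ T₂ × u ≡ v
insert-injective [] [] α β (stop eq) (stop eq′) refl = refl , trans (weight≡0 α eq) (sym (weight≡0 β eq′))
insert-injective [] [] α β (grow _) (grow _) refl = refl , refl
insert-injective [] (f ∷ _) α β (grow {v = v} _) (step _ _) eq =
  contradiction (constant-small (weight v) (Filled.small f) (cong proj₂ (∷-injectiveˡ eq))) (Filled.nonzero f)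
insert-injective (f ∷ _) [] α β (step _ _) (grow {v = v} _) eq =
  contradiction (constant-small (weight v) (Filled.small f) (cong proj₂ (∷-injectiveˡ (sym eq)))) (Filled.nonzero f)
insert-injective (f ∷ fs) (g ∷ gs) α β (step r ins) (step r′ ins′) eq
  with eq₁ , refl ← ∷-injective eq
  with refl , eq₂ ← ,-injective eq₁
  with refl , refl ← split-unique (Filled.small f) (Filled.small g) eq₂
  with refl , refl ← insert-injective fs gs (proj₁ (run-chains r (Filled.chain f)))
                         (proj₁ (run-chains r′ (Filled.chain g))) ins ins′ refl
  with refl , refl ← run-injective r r′ = refl , refl

run-growth : Run (idle 0) u v u′ v′ e → weight v′ ≡ weight u + e
run-growth {u} {v} {u′} {v′} {e} r = +-cancelˡ-≡ (weight u′) _ _ (begin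
  weight u′ + weight v′ ≡⟨ run-weight r ⟨
  weight u + weight v   ≡⟨ cong (_+_ (weight u)) (run-balance r) ⟩
  weight u + (e + weight u′) ≡⟨ +-assoc (weight u) e _ ⟨
  weight u + e + weight u′ ≡⟨ +-comm _ (weight u′) ⟩
  weight u′ + (weight u + e) ∎)
  where open ≡-Reasoning

length-append : ∀ q → length (q ++ replicate e i) ≡ length q + e
length-append {e = e} q = trans (length-++ q) (cong (_+_ (length q)) (length-replicate e))

++-nonempty : q ≢ [] → q ++ r ≢ []
++-nonempty {[]} ne = contradiction refl ne
++-nonempty {_ ∷ _} ne = λ ()

filled-step : Filled n i (u , q) → Run (idle 0) u v u′ v′ e → Filled n (suc i) (v′ , q ++ replicate e i)
filled-step {q = q} {e = e} (filled α sz nz wk sm) r = filled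
  (proj₂ (run-chains r α))
  (trans (length-append q) (trans (cong (_+ e) sz) (sym (run-growth r))))
  (++-nonempty nz)
  (weak-++ wk sm)
  (All.++⁺ (All.map m≤n⇒m≤1+n sm) (all-replicate e))

-- `dyck-run` transports the condition on words. Its equation `a = e + g` says that the upper row
-- exceeded the lower one by at least `e`, which is the length bound of `column-++`.
adjacent-step : Filled n i (u , q) → length r ≡ weight w → Adjacent (u , q) (w , r) →
                Run (idle 0) u v u′ v′ d → Run (idle 0) w u′ w′ x₁ e →
                Adjacent (v′ , q ++ replicate d i) (x₁ , r ++ replicate e i)
adjacent-step {u = u} {q} {r} {w} {d = d} {e = e} f sz ((a , D) , C) R R′
  with g , refl , D′ ← dyck-run R R′ D =
  (_ , D′) , column-++ {d = d} (Filled.small f) C (begin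
    length r + e ≡⟨ cong (_+ e) sz ⟩
    weight w + e ≤⟨ m≤m+n (weight w + e) g ⟩
    weight w + e + g ≡⟨ trans (+-assoc (weight w) e g) (+-comm (weight w) (e + g)) ⟩
    e + g + weight w ≡⟨ suc-injective (dyck-balance D) ⟨
    weight u ≡⟨ Filled.size f ⟨
    length q ∎)
  where open ≤-Reasoning

insert-cells : All (Filled n i) T → Chain false n v → Insert i T v T′ → All (Filled n (suc i)) T′
insert-cells [] β (stop _) = []
insert-cells [] β (grow {v = v} ne) = filled β
  (length-replicate (weight v))
  (λ eq → ne (trans (sym (length-replicate (weight v))) (cong length eq)))
  (weak-++ {e = weight v} [] [])
  (all-replicate (weight v)) ∷ []
insert-cells (f ∷ fs) β (step r ins) = filled-step f r ∷ insert-cells fs (proj₁ (run-chains r (Filled.chain f))) ins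

insert-links : All (Filled n i) T → Linked Adjacent T → Chain false n v → Insert i T v T′ → Linked Adjacent T′
insert-links [] L β (stop _) = []
insert-links [] L β (grow _) = [-]
insert-links (f ∷ []) L β (step r (stop _)) = [-]
-- The new row arises from a virtual row `zeros n` with nothing recorded.
insert-links {n = n} {T = (_ , q) ∷ []} (f ∷ []) L β (step r (grow ne)) =
  adjacent-step f (sym (weight-zeros n)) ((_ , dyck-zeros (Filled.chain f)) , column-[] q) r
    (run-zeros (proj₁ (run-chains r (Filled.chain f)))) ∷ [-]
insert-links (f ∷ g ∷ fs) (A ∷ L) β (step r (step r′ ins)) =
  adjacent-step f (Filled.size g) A r r′ ∷ insert-links (g ∷ fs) L (proj₁ (run-chains r (Filled.chain f))) (step r′ ins)

insert-valid : Valid n i T → Chain false n v → Insert i T v T′ → Valid n (suc i) T′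
insert-valid (valid fs L) β ins = valid (insert-cells fs β ins) (insert-links fs L β ins)

dyck-excess : Dyck 1 v u d → weight v ≤ k → weight u ≡ k + e → e ≤ d
dyck-excess {v} {u} {d} {k} {e} D le eq = +-cancelˡ-≤ k e d (begin
  k + e        ≡⟨ eq ⟨
  weight u     ≡⟨ suc-injective (dyck-balance D) ⟩
  d + weight v ≤⟨ +-monoʳ-≤ d le ⟩
  d + k        ≡⟨ +-comm d k ⟩
  k + d        ∎)
  where open ≤-Reasoning

-- The `e` copies of `i` have nothing beneath them, so the upper row is longer by at least `e`; this
-- is the side condition of `unrun`.
adjacent-excess : Filled n (suc i) (u , q ++ replicate e i) → Filled n (suc i) (v , r) →
                  Adjacent (u , q ++ replicate e i) (v , r) → ∃[ d ] e ≤ d × Dyck 1 v u d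
adjacent-excess {u = u} {q} {e} {v} {r} f g ((d , D) , C) =
  d , dyck-excess D (subst (_≤ length q) (Filled.size g) (column-length q C (Filled.small g) (begin
    length r ≡⟨ Filled.size g ⟩
    weight v ≤⟨ m≤n+m (weight v) d ⟩
    d + weight v ≡⟨ suc-injective (dyck-balance D) ⟨
    weight u ≡⟨ size ⟩
    length q + e ∎))) size , D
  where
  open ≤-Reasoning
  size : weight u ≡ length q + e
  size = trans (sym (Filled.size f)) (length-append q)

filled-unstep : Filled n (suc i) (v′ , q ++ replicate e i) → q ≢ [] → All (_< i) q →
                Chain false n u → Run (idle 0) u v u′ v′ e → Filled n i (u , q)
filled-unstep {q = q} {e = e} (filled _ sz _ wk _) ne sm α r = filled α
  (+-cancelʳ-≡ e _ _ (trans (sym (length-append q)) (trans sz (run-growth r))))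
  ne (weak-prefix q wk) sm

Uninsert : (n i : ℕ) → List Cell → Set
Uninsert n i T′ = ∃[ T ] ∃[ v ] Valid n i T × Chain false n v × Insert i T v T′

-- Rows are undone from the bottom up: the word `v` taken out of the rows below is what the run in
-- this row had sent down.
uninsert-∷ : Filled n (suc i) (u , q ++ replicate e i) → q ≢ [] → All (_< i) q →
             Valid n i T → Chain false n v → Insert i T v T′ → All (Filled n (suc i)) T′ →
             Linked Adjacent ((u , q ++ replicate e i) ∷ T′) → Uninsert n i ((u , q ++ replicate e i) ∷ T′)
uninsert-∷ {u = u} {q} f ne sm V β (stop eq) [] _
  with refl ← weight≡0 β eq
  with _ , _ , α , γ , R ← unrun β (Filled.chain f) (dyck-zeros (Filled.chain f))
                             (subst (_ ≤_) (trans (sym (length-append q)) (Filled.size f)) (m≤n+m _ (length q))) =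
  _ , _ , valid (filled-unstep f ne sm α R ∷ []) [-] , γ , step R (stop eq)
uninsert-∷ f ne sm V β (grow nz) (g ∷ []) (A ∷ _)
  with d , le , D ← adjacent-excess f g A
  with _ , _ , α , γ , R ← unrun β (Filled.chain f) D le =
  _ , _ , valid (filled-unstep f ne sm α R ∷ []) [-] , γ , step R (grow nz)
uninsert-∷ {q = q} f ne sm (valid (h ∷ hs) L) β (step {q = r} R′ ins) (g ∷ _) (A ∷ _)
  with d , le , D ← adjacent-excess f g A
  -- `D` compares `u` with the new row below, but `unrun` needs the comparison with the word
  -- inserted into that row.
  with _ , le′ , D′ ← dyck-unrun 0 R′ D
  with _ , _ , α , γ , R ← unrun β (Filled.chain f) D′ (≤-trans le le′) =
  _ , _ , valid (filled-unstep f ne sm α R ∷ h ∷ hs) ((run-dyck R R′ D le , column-prefix q r (proj₂ A)) ∷ L) ,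
  γ , step R (step R′ ins)

-- A row below would need entries larger than `i`. A row recorded by copies of `i` alone thus comes
-- from `grow`.
constant-last : Filled n (suc i) (u , replicate e i) → All (Filled n (suc i)) T →
                Linked Adjacent ((u , replicate e i) ∷ T) → T ≡ []
constant-last _ [] _ = refl
constant-last {e = zero} f _ _ = contradiction refl (Filled.nonzero f)
constant-last {e = suc e} f (_∷_ {x = _ , []} g _) _ = contradiction refl (Filled.nonzero g)
constant-last {e = suc e} f (_∷_ {x = _ , y ∷ _} g _) ((_ , i<y ∷ _) ∷ _)
  with y≤i ∷ _ ← Filled.small g = contradiction i<y (<⇒≱ y≤i)

uninsert : All (Filled n (suc i)) T → Linked Adjacent T → Uninsert n i T
uninsert {n} [] [] = [] , zeros n , valid [] [] , chain-zeros n , stop (weight-zeros n)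
uninsert {n} {i} {(u , _) ∷ _} (f ∷ fs) L with weak-split (Filled.weak f) (Filled.small f)
... | [] , e , refl , _ with refl ← constant-last f fs L =
  [] , u , valid [] [] , Filled.chain f ,
  subst (λ k → Insert i [] u ((u , replicate k i) ∷ [])) (trans (sym (Filled.size f)) (length-replicate e))
    (grow λ eq → Filled.nonzero f (cong (λ k → replicate k i) (trans (sym (length-replicate e)) (trans (Filled.size f) eq))))
... | x ∷ q , e , refl , sm with _ , _ , V , β , ins ← uninsert fs (Linked.tail L) =
  uninsert-∷ f (λ ()) sm V β ins fs L

-- Insertion of all factors

data RSK (f : ℕ → List Bool) : ℕ → List Cell → Set where
  []  : RSK f 0 []
  _▷_ : RSK f i T → Insert i T (f i) T′ → RSK f (suc i) T′

rsk-valid : (∀ i → Chain false n (f i)) → RSK f i T → Valid n i T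
rsk-valid α [] = valid [] []
rsk-valid α (R ▷ ins) = insert-valid (rsk-valid α R) (α _) ins

rsk : (∀ i → Chain false n (f i)) → ∀ i → ∃[ T ] RSK f i T
rsk α zero = [] , []
rsk α (suc i) with T , R ← rsk α i with T′ , ins ← insert (Valid.cells (rsk-valid α R)) (α i) = T′ , R ▷ ins

rsk-unique : RSK f i T₁ → RSK f i T₂ → T₁ ≡ T₂
rsk-unique [] [] = refl
rsk-unique (R ▷ ins) (R′ ▷ ins′) with refl ← rsk-unique R R′ = insert-unique ins ins′

rsk-cong : (∀ {j} → j < i → f j ≡ g j) → RSK f i T → RSK g i T
rsk-cong eq [] = []
rsk-cong eq (_▷_ {T = T} {T′} R ins) =
  rsk-cong (λ lt → eq (m≤n⇒m≤1+n lt)) R ▷ subst (λ v → Insert _ T v T′) (eq ≤-refl) ins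

rsk-injective : (∀ i → Chain false n (f i)) → (∀ i → Chain false n (g i)) →
                RSK f i T → RSK g i T → ∀ {j} → j < i → f j ≡ g j
rsk-injective {f = f} {g} α β (R ▷ ins) (R′ ▷ ins′) {j} j<1+i
  with refl , eq ← insert-injective (Valid.cells (rsk-valid α R)) (Valid.cells (rsk-valid β R′)) (α _) (β _) ins ins′ refl
  with m≤n⇒m<n∨m≡n (s≤s⁻¹ j<1+i)
... | inj₁ j<i = rsk-injective α β R R′ j<i
... | inj₂ refl = eq

insert-zeros : All (Filled n k) T → Insert i T (zeros n) T
insert-zeros {n} [] = stop (weight-zeros n)
insert-zeros {n} {T = (u , q) ∷ T} (c ∷ cs) =
  subst (λ r → Insert _ ((u , q) ∷ T) _ ((u , r) ∷ T)) (++-identityʳ q) (step (run-empty (Filled.chain c)) (insert-zeros cs))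

-- Empty factors change nothing, so the result is independent of the bound chosen for a
-- factorization.
rsk-zeros : (∀ i → Chain false n (f i)) → (∀ i → m ≤ i → f i ≡ zeros n) → RSK f m T → ∀ k → RSK f (k + m) T
rsk-zeros α z R zero = R
rsk-zeros {T = T} α z R (suc k) with R′ ← rsk-zeros α z R k =
  R′ ▷ subst (λ v → Insert _ T v T) (sym (z _ (m≤n+m _ k))) (insert-zeros (Valid.cells (rsk-valid α R′)))

update : (ℕ → List Bool) → ℕ → List Bool → ℕ → List Bool
update f i v j with j ≟ i
... | yes _ = v
... | no _ = f j

update-≡ : ∀ f i v → update f i v i ≡ v
update-≡ f i v with i ≟ i
... | yes _ = refl
... | no i≢i = contradiction refl i≢i

update-≢ : ∀ f v {i j} → j ≢ i → update f i v j ≡ f j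
update-≢ f v {i} {j} j≢i with j ≟ i
... | yes j≡i = contradiction j≡i j≢i
... | no _ = refl

update-chain : (∀ j → Chain false n (f j)) → Chain false n v → ∀ j → Chain false n (update f i v j)
update-chain {i = i} α β j with j ≟ i
... | yes _ = β
... | no _ = α j

-- The last factor is recovered first; `update` adds it to the factors found for the smaller
-- tableau.
unrsk : ∀ i → Valid n i T → ∃[ f ] (∀ j → Chain false n (f j)) × (∀ j → i ≤ j → f j ≡ zeros n) × RSK f i T
unrsk {n} {[]} zero _ = (λ _ → zeros n) , (λ _ → chain-zeros n) , (λ _ _ → refl) , []
-- No entry is below 0, so there is no row before the first insertion.
unrsk {T = (_ , []) ∷ _} zero (valid (c ∷ _) _) = contradiction refl (Filled.nonzero c)
unrsk {T = (_ , _ ∷ _) ∷ _} zero (valid (c ∷ _) _) with () ∷ _ ← Filled.small c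
unrsk {T = T′} (suc i) (valid cs L)
  with T , v , V , β , ins ← uninsert cs L
  with f , α , z , R ← unrsk i V =
  update f i v , update-chain α β ,
  (λ j i<j → trans (update-≢ f v (>⇒≢ i<j)) (z j (<⇒≤ i<j))) ,
  rsk-cong (λ j<i → sym (update-≢ f v (<⇒≢ j<i))) R ▷ subst (λ w → Insert i T w T′) (sym (update-≡ f i v)) ins

-- Content of the recording tableau.

occurrences : ℕ → List ℕ → ℕ
occurrences i xs = length (filter (i ≟_) xs)

contents : List Cell → List ℕ
contents T = concat (map proj₂ T)

occurrences-++ : ∀ i q → occurrences i (q ++ r) ≡ occurrences i q + occurrences i r
occurrences-++ i q = trans (cong length (filter-++ (i ≟_) q _)) (length-++ (filter (i ≟_) q))

occurrences-none : All (i ≢_) q → occurrences i q ≡ 0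
occurrences-none {i} lt = cong length (filter-none (i ≟_) lt)

occurrences-replicate : ∀ e → occurrences i (replicate e i) ≡ e
occurrences-replicate {i} e = trans (cong length (filter-all (i ≟_) (All.replicate⁺ e refl))) (length-replicate e)

-- By `run-balance`, |v| splits into the `e` entries recorded in this row and |u′|, which is
-- recorded further down.
insert-same : Insert i T v T′ → occurrences i (contents T′) ≡ occurrences i (contents T) + weight v
insert-same (stop eq) = sym eq
insert-same {i} (grow {v = v} _) rewrite ++-identityʳ (replicate (weight v) i) = occurrences-replicate (weight v)
insert-same {i} {v = v} (step {u′ = u′} {e = e} {T = T} {T′} {q} r ins) = begin
  occurrences i ((q ++ replicate e i) ++ contents T′)
    ≡⟨ occurrences-++ i (q ++ replicate e i) ⟩
  occurrences i (q ++ replicate e i) + occurrences i (contents T′)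
    ≡⟨ cong₂ _+_ (trans (occurrences-++ i q) (cong (_+_ (occurrences i q)) (occurrences-replicate e))) (insert-same ins) ⟩
  (occurrences i q + e) + (occurrences i (contents T) + weight u′)
    ≡⟨ solve 4 (λ a b c d → (a :+ b) :+ (c :+ d) := (a :+ c) :+ (b :+ d)) refl
         (occurrences i q) e (occurrences i (contents T)) (weight u′) ⟩
  (occurrences i q + occurrences i (contents T)) + (e + weight u′)
    ≡⟨ cong₂ _+_ (occurrences-++ i q) (run-balance r) ⟨
  occurrences i (q ++ contents T) + weight v ∎
  where
  open ≡-Reasoning
  open +-*-Solver

insert-other : i ≢ k → Insert k T v T′ → occurrences i (contents T′) ≡ occurrences i (contents T)
insert-other ne (stop _) = refl
insert-other ne (grow {v = v} _) = occurrences-none (All.++⁺ (All.replicate⁺ (weight v) ne) [])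
insert-other {i} {k} ne (step {e = e} {T = T} {T′} {q} r ins) = begin
  occurrences i ((q ++ replicate e k) ++ contents T′)
    ≡⟨ occurrences-++ i (q ++ replicate e k) ⟩
  occurrences i (q ++ replicate e k) + occurrences i (contents T′)
    ≡⟨ cong₂ _+_ (trans (occurrences-++ i q) (trans
         (cong (_+_ (occurrences i q)) (occurrences-none (All.replicate⁺ e ne))) (+-identityʳ _))) (insert-other ne ins) ⟩
  occurrences i q + occurrences i (contents T)
    ≡⟨ occurrences-++ i q ⟨
  occurrences i (q ++ contents T) ∎
  where open ≡-Reasoning

rsk-fresh : RSK f k T → k ≤ i → occurrences i (contents T) ≡ 0
rsk-fresh [] le = refl
rsk-fresh (R ▷ ins) le = trans (insert-other (>⇒≢ le) ins) (rsk-fresh R (<⇒≤ le))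

rsk-content : RSK f k T → i < k → occurrences i (contents T) ≡ weight (f i)
rsk-content (R ▷ ins) i<1+k with m≤n⇒m<n∨m≡n (s≤s⁻¹ i<1+k)
... | inj₁ i<k = trans (insert-other (<⇒≢ i<k) ins) (rsk-content R i<k)
... | inj₂ refl = trans (insert-same ins) (cong (_+ _) (rsk-fresh R ≤-refl))

-- Words as integer sequences

<suc : ∀ j → j ℤ.< ℤ.suc j
<suc j = ℤ.suc[i]≤j⇒i<j ℤ.≤-refl

≤suc⇒≤+1 : ∀ j → x ℤ.≤ ℤ.suc j → x ℤ.≤ j ℤ.+ + 1
≤suc⇒≤+1 j = subst (_ ℤ.≤_) (ℤ.+-comm (+ 1) j)

≤+1⇒≤suc : ∀ j → x ℤ.≤ j ℤ.+ + 1 → x ℤ.≤ ℤ.suc j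
≤+1⇒≤suc j = subst (_ ℤ.≤_) (ℤ.+-comm j (+ 1))

+2≡suc² : ∀ j → j ℤ.+ + 2 ≡ ℤ.suc (ℤ.suc j)
+2≡suc² j = trans (ℤ.+-comm j (+ 2)) (ℤ.+-assoc (+ 1) (+ 1) j)

positions : ℤ → List Bool → List ℤ
positions j []      = []
positions j (O ∷ w) = positions (ℤ.suc j) w
positions j (I ∷ w) = j ∷ positions (ℤ.suc j) w

length-positions : ∀ w → length (positions j w) ≡ weight w
length-positions []      = refl
length-positions (O ∷ w) = length-positions w
length-positions (I ∷ w) = cong suc (length-positions w)

positions-weight≡0 : ∀ w → weight w ≡ 0 → positions j w ≡ []
positions-weight≡0 [] eq = refl
positions-weight≡0 (O ∷ w) eq = positions-weight≡0 w eq

positions-≥ : ∀ w → All (j ℤ.≤_) (positions j w)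
positions-≥ [] = []
positions-≥ {j} (O ∷ w) = All.map (ℤ.≤-trans (ℤ.i≤suc[i] j)) (positions-≥ w)
positions-≥ {j} (I ∷ w) = ℤ.≤-refl ∷ All.map (ℤ.≤-trans (ℤ.i≤suc[i] j)) (positions-≥ w)

dualDyck-∷ : All (λ y → j ℤ.+ + 2 ℤ.≤ y) xs → DualDyck xs → DualDyck (j ∷ xs)
dualDyck-∷ [] L = [-]
dualDyck-∷ (le ∷ _) L = le ∷ L

positions-dualDyck : Chain p n w → DualDyck (positions j w)
positions-dualDyck [] = []
positions-dualDyck (off α) = positions-dualDyck α
positions-dualDyck (on []) = [-]
positions-dualDyck {j = j} (on (off {w = w} α)) =
  dualDyck-∷ (All.map (subst (ℤ._≤ _) (sym (+2≡suc² j))) (positions-≥ w)) (positions-dualDyck α)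

Above : ℤ → List ℤ → Set
Above j []      = ⊤
Above j (x ∷ _) = j ℤ.≤ x

-- A word preceded by a one cannot start at its first position.
floor : Bool → ℤ → ℤ
floor false j = j
floor true  j = ℤ.suc j

above-gap : DualDyck (x ∷ xs) → Above (ℤ.suc (ℤ.suc x)) xs
above-gap [-] = tt
above-gap {x} (le ∷ _) = subst (ℤ._≤ _) (+2≡suc² x) le

+suc≡suc+ : ∀ j n → j ℤ.+ + suc n ≡ ℤ.suc j ℤ.+ + n
+suc≡suc+ j n = trans (sym (ℤ.+-assoc j (+ 1) (+ n))) (cong (ℤ._+ + n) (ℤ.+-comm j (+ 1)))

chain-positions : ∀ p n → Above (floor p j) xs → DualDyck xs → All (λ x → x ℤ.< j ℤ.+ + n) xs →
                  ∃[ w ] Chain p n w × positions j w ≡ xs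
chain-positions {xs = []} p zero ab L lt = [] , [] , refl
chain-positions {j} {xs = x ∷ xs} p zero ab L (x<j+0 ∷ _) =
  contradiction (subst (x ℤ.<_) (ℤ.+-identityʳ j) x<j+0) (ℤ.≤⇒≯ (j≤x p ab))
  where
  j≤x : ∀ p → floor p j ℤ.≤ x → j ℤ.≤ x
  j≤x false le = le
  j≤x true  le = ℤ.≤-trans (ℤ.i≤suc[i] j) le
chain-positions {xs = []} p (suc n) ab L lt
  with w , α , eq ← chain-positions false n tt [] [] = O ∷ w , off α , eq
chain-positions {j} {xs = x ∷ xs} true (suc n) ab L lt
  with w , α , eq ← chain-positions false n ab L (All.map (subst (_ ℤ.<_) (+suc≡suc+ j n)) lt) = O ∷ w , off α , eq
chain-positions {j} {xs = x ∷ xs} false (suc n) ab L lt with j ℤ.≟ x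
... | no j≢x
  with w , α , eq ← chain-positions false n (ℤ.i<j⇒suc[i]≤j (ℤ.≤∧≢⇒< ab j≢x)) L
                     (All.map (subst (_ ℤ.<_) (+suc≡suc+ j n)) lt) = O ∷ w , off α , eq
... | yes refl
  with _ ∷ lt′ ← lt
  with w , α , eq ← chain-positions true n (above-gap L) (Linked.tail L) (All.map (subst (_ ℤ.<_) (+suc≡suc+ j n)) lt′) =
  I ∷ w , on α , cong (j ∷_) eq

positions-injective : ∀ {p q} → Chain p n v → Chain q n w → positions j v ≡ positions j w → v ≡ w
positions-injective [] [] eq = refl
positions-injective (off α) (off β) eq = cong (O ∷_) (positions-injective α β eq)
positions-injective (on α) (on β) eq = cong (I ∷_) (positions-injective α β (proj₂ (∷-injective eq)))
positions-injective {j = j} (off {w = v} α) (on β) eq =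
  contradiction (All.head (subst (All (ℤ.suc j ℤ.≤_)) eq (positions-≥ v))) (ℤ.<⇒≱ (<suc j))
positions-injective {j = j} (on α) (off {w = w} β) eq =
  contradiction (All.head (subst (All (ℤ.suc j ℤ.≤_)) (sym eq) (positions-≥ w))) (ℤ.<⇒≱ (<suc j))

-- The statistic `di` under a run.

hits : ℤ → List ℤ → ℕ
hits x ys = length (filter (λ y → x ℤ.≟ y ℤ.+ + 1) ys)

cross : List ℤ → List ℤ → ℕ
cross []       ys = 0
cross (x ∷ xs) ys = hits x ys + cross xs ys

hits-++ : ∀ x ys → hits x (ys ++ zs) ≡ hits x ys + hits x zs
hits-++ x ys = trans (cong length (filter-++ _ ys _)) (length-++ (filter _ ys))

cross-++ʳ : ∀ xs ys → cross xs (ys ++ zs) ≡ cross xs ys + cross xs zs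
cross-++ʳ [] ys = refl
cross-++ʳ {zs} (x ∷ xs) ys rewrite hits-++ {zs} x ys | cross-++ʳ {zs} xs ys =
  solve 4 (λ a b c d → (a :+ b) :+ (c :+ d) := (a :+ c) :+ (b :+ d)) refl (hits x ys) (hits x zs) (cross xs ys) (cross xs zs)
  where open +-*-Solver

cross-↭ˡ : xs ↭ ys → cross xs zs ≡ cross ys zs
cross-↭ˡ Perm.refl = refl
cross-↭ˡ {zs = zs} (Perm.prep x p) = cong (_+_ (hits x zs)) (cross-↭ˡ p)
cross-↭ˡ {x ∷ y ∷ xs} {zs = zs} (Perm.swap x y p) rewrite cross-↭ˡ {zs = zs} p =
  solve 3 (λ a b c → a :+ (b :+ c) := b :+ (a :+ c)) refl (hits x zs) (hits y zs) _
  where open +-*-Solver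
cross-↭ˡ (Perm.trans p q) = trans (cross-↭ˡ p) (cross-↭ˡ q)

cross-↭ʳ : ∀ xs → ys ↭ zs → cross xs ys ≡ cross xs zs
cross-↭ʳ [] p = refl
cross-↭ʳ (x ∷ xs) p = cong₂ _+_ (↭-length (filter-↭ _ p)) (cross-↭ʳ xs p)

di-++ : ∀ xs → di (xs ++ ys) ≡ cross xs ys + (di xs + di ys)
di-++ [] = refl
di-++ {ys} (x ∷ xs) rewrite hits-++ {ys} x xs | di-++ {ys} xs =
  solve 5 (λ a b c d e → (a :+ b) :+ (c :+ (d :+ e)) := (b :+ c) :+ ((a :+ d) :+ e)) refl
    (hits x xs) (hits x ys) (cross xs ys) (di xs) (di ys)
  where open +-*-Solver

infix 4 _≈_
_≈_ : List ℤ → List ℤ → Set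
xs ≈ ys = xs ↭ ys × di xs ≡ di ys

≈-refl : xs ≈ xs
≈-refl = ↭-refl , refl

≈-trans : xs ≈ ys → ys ≈ zs → xs ≈ zs
≈-trans (p , eq) (q , eq′) = ↭-trans p q , trans eq eq′

≡⇒≈ : xs ≡ ys → xs ≈ ys
≡⇒≈ refl = ≈-refl

-- The pairs between the two parts depend only on their multisets, so a part may be rearranged as
-- long as its own `di` is kept.
≈-++ : xs ≈ ys → zs ≈ ws → xs ++ zs ≈ ys ++ ws
≈-++ {xs} {ys} {zs} {ws} (p , eq) (q , eq′) = ++⁺ p q , (begin
  di (xs ++ zs)                ≡⟨ di-++ xs ⟩
  cross xs zs + (di xs + di zs) ≡⟨ cong₂ _+_ (trans (cross-↭ˡ p) (cross-↭ʳ ys q)) (cong₂ _+_ eq eq′) ⟩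
  cross ys ws + (di ys + di ws) ≡⟨ di-++ ys ⟨
  di (ys ++ ws) ∎)
  where open ≡-Reasoning

hits-above : ∀ {x ys} → All (x ℤ.≤_) ys → hits x ys ≡ 0
hits-above {x} le = cong length (filter-none (λ y → x ℤ.≟ y ℤ.+ + 1)
  (All.map (λ {y} x≤y x≡y+1 → ℤ.<⇒≱ (subst (y ℤ.<_) (trans (ℤ.+-comm (+ 1) y) (sym x≡y+1)) (<suc y)) x≤y) le))

di-positions : ∀ w → di (positions j w) ≡ 0
di-positions [] = refl
di-positions (O ∷ w) = di-positions w
di-positions {j} (I ∷ w) = cong₂ _+_ (hits-above (All.map (ℤ.≤-trans (ℤ.i≤suc[i] j)) (positions-≥ w))) (di-positions w)

-- The Boolean index of descents is the letter of the second word preceding the words.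
descend : (p x : Bool) → ℕ → ℕ
descend I I k = suc k
descend _ _ k = k

descents : Bool → List Bool → List Bool → ℕ
descents p []      v       = 0
descents p (x ∷ u) []      = descend p x (descents O u [])
descents p (x ∷ u) (y ∷ v) = descend p x (descents y u v)

-- Inside an interchanged block, after a letter of v, the interchanged words are one descent ahead.
indebted : State → ℕ
indebted high* = 1
indebted _ = 0

lastHighIn : State → Bool
lastHighIn (high _) = true
lastHighIn (both _) = true
lastHighIn high* = true
lastHighIn _ = false

-- Outside interchanged blocks the words agree. Inside, the outputs have a descent at each `flip₂`
-- and the inputs at each `flip₁`; these alternate, and the block ends in `low*` with the debt
-- repaid.
run-descents : Run s u v u′ v′ e → descents (lastHighIn s) u v ≡ indebted s + descents (lastHigh s) u′ v′
run-descents (nil idle) = refl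
run-descents (nil low) = refl
run-descents (nil high) = refl
run-descents (nil both) = refl
run-descents (nil low*) = refl
run-descents (none idle r) = run-descents r
run-descents (none low r) = run-descents r
run-descents (none high r) = run-descents r
run-descents (none both r) = run-descents r
run-descents (none low* r) = run-descents r
run-descents (low₀ r) = run-descents r
run-descents (low₁ r) = cong suc (run-descents r)
run-descents (high₀ r) = run-descents r
run-descents (high₁ r) = run-descents r
run-descents (both r) = run-descents r
run-descents (flip₀ r) = run-descents r
run-descents (flip₁ r) = cong suc (run-descents r)
run-descents (flip₂ r) = run-descents r

marker : Bool → ℤ → List ℤ
marker O j = []
marker I j = [ j ]

positions-marker : ∀ x w → positions j (x ∷ w) ≡ marker x j ++ positions (ℤ.suc j) w
positions-marker O w = refl
positions-marker I w = refl

cross-marker : ∀ j p → All (ℤ.suc (ℤ.suc j) ℤ.≤_) xs → cross xs (marker p j ++ ys) ≡ cross xs ys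
cross-marker j O le = refl
cross-marker j I [] = refl
cross-marker {x ∷ xs} {ys} j I (le ∷ les) = cong₂ _+_
  (cong length (filter-reject (λ y → x ℤ.≟ y ℤ.+ + 1) λ x≡j+1 →
    ℤ.<⇒≱ (<suc (ℤ.suc j)) (subst (_ ℤ.≤_) (trans x≡j+1 (ℤ.+-comm j (+ 1))) le)))
  (cross-marker j I les)

hits-marker : ∀ j p → All (ℤ.suc j ℤ.≤_) ys → hits (ℤ.suc j) (marker p j ++ ys) ≡ descend p I 0
hits-marker j O le = hits-above le
hits-marker j I le = trans
  (cong length (filter-accept (λ y → ℤ.suc j ℤ.≟ y ℤ.+ + 1) (ℤ.+-comm (+ 1) j)))
  (cong suc (hits-above le))

descend-+ : ∀ p k → descend p I 0 + k ≡ descend p I k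
descend-+ O k = refl
descend-+ I k = refl

-- An entry meets only the letter of the second word one place before it, so that letter alone is
-- carried along as a marker.
cross-positions : ∀ j p u v → cross (positions (ℤ.suc j) u) (marker p j ++ positions (ℤ.suc j) v) ≡ descents p u v
cross-tail : ∀ j p u v → cross (positions (ℤ.suc (ℤ.suc j)) u) (marker p j ++ positions (ℤ.suc j) v) ≡
             descents O (O ∷ u) v
cross-tail j p u [] = trans (cross-marker j p (positions-≥ u)) (cross-positions (ℤ.suc j) O u [])
cross-tail j p u (y ∷ v) = trans (cross-marker j p (positions-≥ u))
  (trans (cong (cross (positions _ u)) (positions-marker y v)) (cross-positions (ℤ.suc j) y u v))
cross-positions j p [] v = refl
cross-positions j p (O ∷ u) [] = trans (cross-tail j p u []) (sym (descend-O p))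
  where
  descend-O : ∀ p {k} → descend p O k ≡ k
  descend-O O = refl
  descend-O I = refl
cross-positions j O (O ∷ u) (y ∷ v) = cross-tail j O u (y ∷ v)
cross-positions j I (O ∷ u) (y ∷ v) = cross-tail j I u (y ∷ v)
cross-positions j p (I ∷ u) [] = trans (cong₂ _+_ (hits-marker j p (positions-≥ [])) (cross-tail j p u [])) (descend-+ p _)
cross-positions j p (I ∷ u) (y ∷ v) =
  trans (cong₂ _+_ (hits-marker j p (positions-≥ (y ∷ v))) (cross-tail j p u (y ∷ v))) (descend-+ p _)

run-cross : Run (idle c) u v u′ v′ e → cross (positions j u) (positions j v) ≡ cross (positions j u′) (positions j v′)
run-cross {u = u} {v} {u′} {v′} {j = j} r = subst
  (λ j → cross (positions j u) (positions j v) ≡ cross (positions j u′) (positions j v′))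
  (ℤ.suc-pred j) (trans (cross-positions (ℤ.pred j) O u v) (trans (run-descents r) (sym (cross-positions (ℤ.pred j) O u′ v′))))

run-↭ : ∀ j → Run s u v u′ v′ e → positions j u ++ positions j v ↭ positions j u′ ++ positions j v′
run-↭ j (nil _) = ↭-refl
run-↭ j (none _ r) = run-↭ (ℤ.suc j) r
run-↭ j (low₀ r) = ↭-prep j (run-↭ (ℤ.suc j) r)
run-↭ j (low₁ r) = ↭-prep j (run-↭ (ℤ.suc j) r)
run-↭ j (high₀ r) = ↭-trans (shift j _ _) (↭-trans (↭-prep j (run-↭ (ℤ.suc j) r)) (↭-sym (shift j _ _)))
run-↭ j (high₁ r) = ↭-trans (shift j _ _) (↭-trans (↭-prep j (run-↭ (ℤ.suc j) r)) (↭-sym (shift j _ _)))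
run-↭ j (both r) = ↭-prep j (↭-trans (shift j _ _) (↭-trans (↭-prep j (run-↭ (ℤ.suc j) r)) (↭-sym (shift j _ _))))
run-↭ j (flip₀ r) = ↭-trans (↭-prep j (run-↭ (ℤ.suc j) r)) (↭-sym (shift j _ _))
run-↭ j (flip₁ r) = ↭-trans (↭-prep j (run-↭ (ℤ.suc j) r)) (↭-sym (shift j _ _))
run-↭ j (flip₂ r) = ↭-trans (shift j _ _) (↭-prep j (run-↭ (ℤ.suc j) r))

di-pair : ∀ u v → di (positions j u ++ positions j v) ≡ cross (positions j u) (positions j v)
di-pair {j} u v rewrite di-++ {positions j v} (positions j u) | di-positions {j} u | di-positions {j} v = +-identityʳ _

run-≈ : Run (idle c) u v u′ v′ e → positions j u ++ positions j v ≈ positions j u′ ++ positions j v′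
run-≈ {u = u} {v} {u′} {v′} r = run-↭ _ r , trans (di-pair u v) (trans (run-cross r) (sym (di-pair u′ v′)))

-- The column condition on integer rows.

infix 4 _⊴_
_⊴_ : List ℤ → List ℤ → Set
_⊴_ = Columnwise (λ a b → a ℤ.≤ b ℤ.+ + 1)

⊴-head : ∀ j → x ℤ.≤ ℤ.suc j → x ∷ xs ⊴ z ∷ ys → x ∷ xs ⊴ j ∷ ys
⊴-head j le (_ ∷ C) = ≤suc⇒≤+1 j le ∷ C

≤⇒≤suc : x ℤ.≤ j → x ℤ.≤ ℤ.suc j
≤⇒≤suc {j = j} le = ℤ.≤-trans le (ℤ.i≤suc[i] j)

length-∷ʳ : ∀ us → length (us ∷ʳ x) ≡ suc (length us)
length-∷ʳ us = trans (length-++ us) (+-comm (length us) 1)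

queue : ∀ {us} → All (ℤ._≤ j) us → All (ℤ._≤ ℤ.suc j) (us ∷ʳ ℤ.suc j)
queue les = All.++⁺ (All.map ≤⇒≤suc les) (ℤ.≤-refl ∷ [])

-- The queue us holds the entries of the upper row not yet matched, and j is a sentinel of the lower row.
dyck-⊴ : ∀ j us → length us ≡ d → All (ℤ._≤ j) us → Dyck d v u e →
         us ++ positions (ℤ.suc j) u ⊴ j ∷ positions (ℤ.suc j) v
dyck-⊴ j (x ∷ us) eq (le ∷ les) nil = ≤suc⇒≤+1 j (≤⇒≤suc le) ∷ subst (All _) (sym (zipWith-zeroʳ _ (us ++ []))) []
dyck-⊴ j (x ∷ us) eq (le ∷ les) (none {u = v} {v = u} D) =
  ⊴-head {xs = us ++ positions _ u} j (≤⇒≤suc le) (dyck-⊴ (ℤ.suc j) (x ∷ us) eq (All.map ≤⇒≤suc (le ∷ les)) D)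
dyck-⊴ j (x ∷ us) eq (le ∷ les) (bot D) =
  ≤suc⇒≤+1 j (≤⇒≤suc le) ∷ dyck-⊴ (ℤ.suc j) us (suc-injective eq) (All.map ≤⇒≤suc les) D
dyck-⊴ j [] refl [] (top {v = u} D) =
  ⊴-head {xs = positions _ u} j ℤ.≤-refl (dyck-⊴ (ℤ.suc j) [ ℤ.suc j ] refl (ℤ.≤-refl ∷ []) D)
dyck-⊴ j (x ∷ us) refl (le ∷ les) (top {u = v} {v = u} D)
  rewrite sym (∷ʳ-++ us (ℤ.suc j) (positions (ℤ.suc (ℤ.suc j)) u)) =
  ⊴-head {xs = (us ∷ʳ ℤ.suc j) ++ positions _ u} j (≤⇒≤suc le)
    (dyck-⊴ (ℤ.suc j) (x ∷ us ∷ʳ ℤ.suc j) (cong suc (length-∷ʳ us)) (queue (le ∷ les)) D)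
dyck-⊴ j [] refl [] (both D) = ≤suc⇒≤+1 j ℤ.≤-refl ∷ dyck-⊴ (ℤ.suc j) [] refl [] D
dyck-⊴ j (x ∷ us) refl (le ∷ les) (both {u = v} {v = u} D)
  rewrite sym (∷ʳ-++ us (ℤ.suc j) (positions (ℤ.suc (ℤ.suc j)) u)) =
  ≤suc⇒≤+1 j (≤⇒≤suc le) ∷ dyck-⊴ (ℤ.suc j) (us ∷ʳ ℤ.suc j) (length-∷ʳ us) (queue les) D

⊴-deficit : ∀ j u → 0 < weight u → positions (ℤ.suc (ℤ.suc j)) u ⊴ j ∷ ys → ⊥
⊴-deficit j u 0<w C
  with positions (ℤ.suc (ℤ.suc j)) u | positions-≥ {ℤ.suc (ℤ.suc j)} u | length-positions {ℤ.suc (ℤ.suc j)} u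
... | [] | _ | eq = <-irrefl eq 0<w
... | x ∷ _ | le ∷ _ | _ with x≤j+1 ∷ _ ← C = ℤ.<⇒≱ (<suc (ℤ.suc j)) (ℤ.≤-trans le (≤+1⇒≤suc j x≤j+1))

queue-weight : ∀ us u → suc (length us) + suc (weight u) ≡ suc (length (us ∷ʳ x)) + weight u
queue-weight us u = trans (+-suc (suc (length us)) (weight u)) (cong (λ k → suc k + weight u) (sym (length-∷ʳ us)))

-- The queue of `dyck-⊴` is rebuilt. If it is empty and the upper word has no letter next, some
-- upper entry of at least `j + 2` stands above the sentinel `j`; the weight bound ensures that this
-- entry exists.
⊴-dyck : ∀ {p q} j us → Chain p n u → Chain q n v → All (ℤ._≤ j) us →
         us ++ positions (ℤ.suc j) u ⊴ j ∷ positions (ℤ.suc j) v →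
         weight v < length us + weight u → ∃[ e ] Dyck (length us) v u e
⊴-dyck j (x ∷ us) [] [] les C lt = _ , nil
⊴-dyck j [] (off {w = u} α) (off β) les C lt = ⊥-elim (⊴-deficit j u (≤-<-trans z≤n lt) C)
⊴-dyck j [] (off {w = u} α) (on β) les C lt = ⊥-elim (⊴-deficit j u (≤-<-trans z≤n lt) C)
⊴-dyck j (x ∷ us) (off {w = u} α) (off β) (le ∷ les) C lt
  with e , D ← ⊴-dyck (ℤ.suc j) (x ∷ us) α β (All.map ≤⇒≤suc (le ∷ les)) 
                 (⊴-head {xs = us ++ positions _ u} (ℤ.suc j) (≤⇒≤suc (≤⇒≤suc le)) C) lt = e , none D
⊴-dyck j (x ∷ us) (off α) (on β) (le ∷ les) (_ ∷ C) lt
  with e , D ← ⊴-dyck (ℤ.suc j) us α β (All.map ≤⇒≤suc les) C (s≤s⁻¹ lt) = e , bot D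
⊴-dyck j [] (on {w = u} α) (off β) [] C lt
  with e , D ← ⊴-dyck (ℤ.suc j) [ ℤ.suc j ] α β (ℤ.≤-refl ∷ []) 
                 (⊴-head {xs = positions _ u} (ℤ.suc j) (ℤ.i≤suc[i] _) C) lt = e , top D
⊴-dyck j (x ∷ us) (on {w = u} α) (off {w = v} β) (le ∷ les) C lt
  rewrite sym (∷ʳ-++ us (ℤ.suc j) (positions (ℤ.suc (ℤ.suc j)) u))
  with e , D ← ⊴-dyck (ℤ.suc j) (x ∷ us ∷ʳ ℤ.suc j) α β (queue (le ∷ les))
                 (⊴-head {xs = (us ∷ʳ ℤ.suc j) ++ positions _ u} (ℤ.suc j) (≤⇒≤suc (≤⇒≤suc le)) C)
                 (subst (weight v <_) (queue-weight us u) lt) =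
  e , top (dyck-cast (cong suc (length-∷ʳ us)) D)
⊴-dyck j [] (on α) (on β) [] (_ ∷ C) lt with e , D ← ⊴-dyck (ℤ.suc j) [] α β [] C (s≤s⁻¹ lt) = e , both D
⊴-dyck j (x ∷ us) (on {w = u} α) (on {w = v} β) (le ∷ les) (_ ∷ C) lt
  rewrite sym (∷ʳ-++ us (ℤ.suc j) (positions (ℤ.suc (ℤ.suc j)) u))
  with e , D ← ⊴-dyck (ℤ.suc j) (us ∷ʳ ℤ.suc j) α β (queue les) C
                 (s≤s⁻¹ (subst (suc (weight v) <_) (queue-weight us u) lt)) =
  e , both (dyck-cast (length-∷ʳ us) D)

dyck⇒columnwise : ∀ j → Dyck 1 v u e → positions j u ⊴ positions j v
dyck⇒columnwise {v} {u} j D = subst (λ j → positions j u ⊴ positions j v) (ℤ.suc-pred j)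
  -- Index 1 means a queue of one entry: `pred j` is placed in front of both rows and removed again.
  (All.tail (dyck-⊴ (ℤ.pred j) [ ℤ.pred j ] refl (ℤ.≤-refl ∷ []) D))

columnwise⇒dyck : ∀ {p q} j → Chain p n u → Chain q n v → positions j u ⊴ positions j v →
                  weight v ≤ weight u → ∃[ e ] Dyck 1 v u e
columnwise⇒dyck {u = u} {v} j α β C le = ⊴-dyck (ℤ.pred j) [ ℤ.pred j ] α β (ℤ.≤-refl ∷ [])
  (≤suc⇒≤+1 (ℤ.pred j) (ℤ.i≤suc[i] _) ∷ subst (λ j → positions j u ⊴ positions j v) (sym (ℤ.suc-pred j)) C) (s≤s le)

-- The bijection

bottomUp : ℤ → List Cell → List ℤ
bottomUp j []            = []
bottomUp j ((u , _) ∷ T) = bottomUp j T ++ positions j u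

wordRows : ℤ → List Cell → List (List ℤ)
wordRows j = map (positions j ∘ proj₁)

bottomUp-reverse : ∀ T → concat (reverse (wordRows j T)) ≡ bottomUp j T
bottomUp-reverse [] = refl
bottomUp-reverse {j} ((u , _) ∷ T) = begin
  concat (reverse (positions j u ∷ wordRows j T)) ≡⟨ cong concat (unfold-reverse (positions j u) (wordRows j T)) ⟩
  concat (reverse (wordRows j T) ++ [ positions j u ]) ≡⟨ concat-++ (reverse (wordRows j T)) _ ⟨
  concat (reverse (wordRows j T)) ++ (positions j u ++ []) ≡⟨ cong₂ _++_ (bottomUp-reverse T) (++-identityʳ _) ⟩
  bottomUp j T ++ positions j u ∎
  where open ≡-Reasoning

bottomUp-↭ : ∀ T → concat (wordRows j T) ↭ bottomUp j T
bottomUp-↭ [] = ↭-refl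
bottomUp-↭ {j} ((u , _) ∷ T) = ↭-trans (++⁺ˡ (positions j u) (bottomUp-↭ T)) (++-comm (positions j u) (bottomUp j T))

-- The top row `u` ends the reading word and so stands next to `v`. Replacing `u v` by `u′ v′`
-- leaves the new row at the end and `u′` next to the rows below.
insert-≈ : Insert i T v T′ → bottomUp j T ++ positions j v ≈ bottomUp j T′
insert-≈ (stop {v = v} eq) = ≡⇒≈ (positions-weight≡0 v eq)
insert-≈ (grow _) = ≈-refl
insert-≈ {j = j} (step {u = u} {v = v} {u′} {v′} {T = T} r ins) =
  ≈-trans (≡⇒≈ (++-assoc (bottomUp j T) (positions j u) (positions j v)))
  (≈-trans (≈-++ {bottomUp j T} ≈-refl (run-≈ r))
  (≈-trans (≡⇒≈ (sym (++-assoc (bottomUp j T) (positions j u′) (positions j v′))))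
  (≈-++ (insert-≈ ins) ≈-refl)))

concat-applyUpTo : ∀ {A : Set} (f : ℕ → List A) k → concat (applyUpTo f (suc k)) ≡ concat (applyUpTo f k) ++ f k
concat-applyUpTo f k = begin
  concat (applyUpTo f (suc k)) ≡⟨ cong concat (applyUpTo-∷ʳ f k) ⟨
  concat (applyUpTo f k ∷ʳ f k) ≡⟨ concat-++ (applyUpTo f k) [ f k ] ⟨
  concat (applyUpTo f k) ++ (f k ++ []) ≡⟨ cong (concat (applyUpTo f k) ++_) (++-identityʳ (f k)) ⟩
  concat (applyUpTo f k) ++ f k ∎
  where open ≡-Reasoning

applyUpTo-cong : ∀ {A : Set} {f g : ℕ → A} → (∀ i → f i ≡ g i) → ∀ k → applyUpTo f k ≡ applyUpTo g k
applyUpTo-cong eq zero = refl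
applyUpTo-cong eq (suc k) = cong₂ _∷_ (eq 0) (applyUpTo-cong (eq ∘ suc) k)

rsk-≈ : RSK f k T → concat (applyUpTo (positions j ∘ f) k) ≈ bottomUp j T
rsk-≈ [] = ≈-refl
rsk-≈ {f = f} {k = suc k} {j = j} (R ▷ ins) =
  ≈-trans (≡⇒≈ (concat-applyUpTo (positions j ∘ f) k)) (≈-trans (≈-++ (rsk-≈ R) ≈-refl) (insert-≈ ins))

-- Both insertions are continued with empty factors to the common bound `m + k`.
rsk-agree : (∀ i → Chain false n (f i)) → (∀ i → f i ≡ g i) →
            (∀ i → k ≤ i → f i ≡ zeros n) → (∀ i → m ≤ i → g i ≡ zeros n) →
            RSK f k T₁ → RSK g m T₂ → T₁ ≡ T₂
rsk-agree {f = f} {g = g} {k = k} {m = m} {T₂ = T₂} α eq z z′ R R′ = rsk-unique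
  (rsk-zeros α z R m)
  (subst (λ i → RSK f i T₂) (+-comm k m)
    (rsk-cong (λ {j} _ → sym (eq j)) (rsk-zeros (λ i → subst (Chain false _) (eq i) (α i)) z′ R′ k)))

-- A finite window of integers.

InWindow : ℤ → ℕ → ℤ → Set
InWindow j n x = j ℤ.≤ x × x ℤ.< j ℤ.+ + n

i≤+∣i∣ : ∀ i → i ℤ.≤ + ℤ.∣ i ∣
i≤+∣i∣ (+ n) = ℤ.≤-refl
i≤+∣i∣ -[1+ n ] = ℤ.-≤+

-- All factors and rows use entries of `S` only, so one interval encodes them as words of one
-- length. The default 0 may enlarge it and covers an empty `S`.
window : ∀ S → ∃[ j ] ∃[ n ] All (InWindow j n) S
window S = lo , suc ℤ.∣ hi ℤ.- lo ∣ , All.zipWith (λ (l , r) → l , upper r) (min≤xs (+ 0) S , xs≤max (+ 0) S)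
  where
  lo = min (+ 0) S
  hi = max (+ 0) S
  upper : x ℤ.≤ hi → x ℤ.< lo ℤ.+ + suc ℤ.∣ hi ℤ.- lo ∣
  upper {x} x≤hi = begin-strict
    x ≤⟨ x≤hi ⟩
    hi ≡⟨ ℤ.+-identityˡ hi ⟨
    + 0 ℤ.+ hi ≡⟨ cong (ℤ._+ hi) (ℤ.+-inverseʳ lo) ⟨
    lo ℤ.- lo ℤ.+ hi ≡⟨ ℤ.+-assoc lo (ℤ.- lo) hi ⟩
    lo ℤ.+ (ℤ.- lo ℤ.+ hi) ≡⟨ cong (λ z → lo ℤ.+ z) (ℤ.+-comm (ℤ.- lo) hi) ⟩
    lo ℤ.+ (hi ℤ.- lo) ≤⟨ ℤ.+-monoʳ-≤ lo (i≤+∣i∣ (hi ℤ.- lo)) ⟩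
    lo ℤ.+ + ℤ.∣ hi ℤ.- lo ∣ <⟨ ℤ.+-monoʳ-< lo (ℤ.+<+ ≤-refl) ⟩
    lo ℤ.+ + suc ℤ.∣ hi ℤ.- lo ∣ ∎
    where open ℤ.≤-Reasoning

above-window : All (InWindow j n) xs → Above j xs
above-window [] = _
above-window ((le , _) ∷ _) = le

encode : DualDyck xs → All (InWindow j n) xs → ∃[ w ] Chain false n w × positions j w ≡ xs
encode {n = n} L ws = chain-positions false n (above-window ws) L (All.map proj₂ ws)

filled-nonempty : Filled n i (u , q) → positions j u ≢ []
filled-nonempty {u = u} {q = []} f eq = Filled.nonzero f refl
filled-nonempty {u = u} {q = _ ∷ _} f eq with () ← trans (Filled.size f) (trans (sym (length-positions u)) (cong length eq))

cells-shape : All (Filled n i) T → map length (map proj₂ T) ≡ map length (wordRows j T)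
cells-shape [] = refl
cells-shape {T = (u , _) ∷ _} (f ∷ fs) = cong₂ _∷_ (trans (Filled.size f) (sym (length-positions u))) (cells-shape fs)

dyck-length : Dyck 1 v u e → length (positions j u) ≥ length (positions j v)
dyck-length {v} {u} {e} {j} D rewrite length-positions {j} u | length-positions {j} v =
  ≤-trans (m≤n+m _ e) (≤-reflexive (sym (suc-injective (dyck-balance D))))

-- From cells to pairs of tableaux and back.

tableauPair : ∀ {S d} j → Valid n i T → bottomUp j T ↭ S → di (bottomUp j T) ≡ d → TableauPair S d
tableauPair {T = T} j (valid fs L) perm eq = record
  { P = record
    { tableau = record
      { rows = wordRows j T
      ; nonempty = All.map⁺ (All.map filled-nonempty fs)
      ; decreasing = Linked.map⁺ (Linked.map (λ ((_ , D) , _) → dyck-length D) L)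
      }
    ; rowsDualDyck = All.map⁺ (All.map (positions-dualDyck {j = j} ∘ Filled.chain) fs)
    ; columns = Linked.map⁺ (Linked.map (λ ((_ , D) , _) → dyck⇒columnwise j D) L)
    }
  ; Q = record
    { tableau = record
      { rows = map proj₂ T
      ; nonempty = All.map⁺ (All.map Filled.nonzero fs)
      ; decreasing = Linked.map⁺ (decreasing fs L)
      }
    ; rowsWeak = All.map⁺ (All.map Filled.weak fs)
    ; columnsStrict = Linked.map⁺ (Linked.map proj₂ L)
    }
  ; entries-P = ↭-trans (bottomUp-↭ T) perm
  ; di-RR = trans (cong di (bottomUp-reverse T)) eq
  ; sameShape = cells-shape fs
  }
  where
  decreasing : ∀ {T} → All (Filled _ _) T → Linked Adjacent T → Linked (λ c c′ → length (proj₂ c) ≥ length (proj₂ c′)) T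
  decreasing fs [] = []
  decreasing fs [-] = [-]
  decreasing {(u , _) ∷ (v , _) ∷ _} (f ∷ g ∷ fs) (((_ , D) , _) ∷ L) =
    subst₂ _≥_ (trans (length-positions u) (sym (Filled.size f))) (trans (length-positions v) (sym (Filled.size g)))
      (dyck-length {j = + 0} D) ∷ decreasing (g ∷ fs) L

fill : ∀ ps qs → map length qs ≡ map length ps → All DualDyck ps → All (All (InWindow j n)) ps →
       All (_≢ []) qs → All (Linked _≤_) qs → All (All (_< i)) qs →
       ∃[ T ] All (Filled n i) T × wordRows j T ≡ ps × map proj₂ T ≡ qs
fill [] [] eq [] [] [] [] [] = [] , [] , refl , refl
fill (p ∷ ps) (q ∷ qs) eq (D ∷ Ds) (W ∷ Ws) (N ∷ Ns) (L ∷ Ls) (B ∷ Bs)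
  with eq₁ , eqs ← ∷-injective eq
  with u , α , refl ← encode D W
  with T , fs , refl , refl ← fill ps qs eqs Ds Ws Ns Ls Bs =
  (u , q) ∷ T , filled α (trans eq₁ (length-positions u)) N L B ∷ fs , refl , refl

link : All (Filled n i) T → Linked _⊴_ (wordRows j T) → Linked (λ u v → length u ≥ length v) (wordRows j T) →
       Linked (Columnwise _<_) (map proj₂ T) → Linked Adjacent T
link [] _ _ _ = []
link (_ ∷ []) _ _ _ = [-]
link {T = (u , _) ∷ (v , _) ∷ _} {j = j} (f ∷ g ∷ fs) (C ∷ Cs) (le ∷ les) (C′ ∷ Cs′) =
  (columnwise⇒dyck j (Filled.chain f) (Filled.chain g) C (subst₂ _≤_ (length-positions v) (length-positions u) le) , C′) ∷
  link (g ∷ fs) Cs les Cs′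

cells-injective : All (Filled n i) T₁ → All (Filled n k) T₂ → wordRows j T₁ ≡ wordRows j T₂ →
                  map proj₂ T₁ ≡ map proj₂ T₂ → T₁ ≡ T₂
cells-injective [] [] eq eq′ = refl
cells-injective (f ∷ fs) (g ∷ gs) eq eq′
  with eq₁ , eq₂ ← ∷-injective eq | refl , eq₃ ← ∷-injective eq′
  with refl ← positions-injective (Filled.chain f) (Filled.chain g) eq₁ = cong (_ ∷_) (cells-injective fs gs eq₂ eq₃)

positions-zeros : ∀ n → positions j (zeros n) ≡ []
positions-zeros n = positions-weight≡0 (zeros n) (weight-zeros n)

positions≡[] : Chain p n w → positions j w ≡ [] → w ≡ zeros n
positions≡[] {n = n} {j = j} α eq = positions-injective α (chain-zeros {false} n) (trans eq (sym (positions-zeros {j = j} n)))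

-- Insertion as a bijection of setoids.

module _ (S : List ℤ) (d : ℕ) where

  open DualDyckFactorization
  open TableauPair

  origin : ℤ
  origin = proj₁ (window S)

  width : ℕ
  width = proj₁ (proj₂ (window S))

  inWindow : All (InWindow origin width) S
  inWindow = proj₂ (proj₂ (window S))

  factor-inWindow : (F : DualDyckFactorization S d) → ∀ i → All (InWindow origin width) (factor F i)
  factor-inWindow F i with i <? bound F
  ... | yes i<b = All.applyUpTo⁻ (factor F) (bound F)
                    (All.concat⁻ (All-resp-↭ (↭-sym (factorizes F)) inWindow)) i<b
  ... | no i≮b = subst (All _) (sym (vanishes F i (≮⇒≥ i≮b))) []

  module Insertion (F : DualDyckFactorization S d) where

    code : ∀ i → ∃[ w ] Chain false width w × positions origin w ≡ factor F i
    code i = encode (dualDyck F i) (factor-inWindow F i)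

    word : ℕ → List Bool
    word i = proj₁ (code i)

    word-chain : ∀ i → Chain false width (word i)
    word-chain i = proj₁ (proj₂ (code i))

    positions-word : ∀ i → positions origin (word i) ≡ factor F i
    positions-word i = proj₂ (proj₂ (code i))

    word-vanishes : ∀ i → bound F ≤ i → word i ≡ zeros width
    word-vanishes i le = positions≡[] (word-chain i) (trans (positions-word i) (vanishes F i le))

    cells : List Cell
    cells = proj₁ (rsk word-chain (bound F))

    insertion : RSK word (bound F) cells
    insertion = proj₂ (rsk word-chain (bound F))

    cells-valid : Valid width (bound F) cells
    cells-valid = rsk-valid word-chain insertion

    product-≈ : product F ≈ bottomUp origin cells
    product-≈ = ≈-trans (≡⇒≈ (cong concat (applyUpTo-cong (sym ∘ positions-word) (bound F)))) (rsk-≈ insertion)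

    pair : TableauPair S d
    pair = tableauPair origin cells-valid
      (↭-trans (↭-sym (proj₁ product-≈)) (factorizes F))
      (trans (sym (proj₂ product-≈)) (di-product F))

    content : ∀ i → SSYT.m (TableauPair.Q pair) i ≡ length (factor F i)
    content i with i <? bound F
    ... | yes i<b = trans (rsk-content insertion i<b) (trans (sym (length-positions (word i))) (cong length (positions-word i)))
    ... | no i≮b = trans (rsk-fresh insertion (≮⇒≥ i≮b)) (sym (cong length (vanishes F i (≮⇒≥ i≮b))))

  open Insertion
  open Setoid (DualDyckFactorizations S d) using () renaming (_≈_ to _≈ᶠ_)
  open Setoid (TableauPairs S d) using () renaming (_≈_ to _≈ᵗ_)

  cells-cong : ∀ F G → F ≈ᶠ G → cells F ≡ cells G
  cells-cong F G eq = rsk-agree (word-chain F)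
    (λ i → positions-injective (word-chain F i) (word-chain G i)
      (trans (positions-word F i) (trans (eq i) (sym (positions-word G i)))))
    (word-vanishes F) (word-vanishes G) (insertion F) (insertion G)

  pair-cong : ∀ {F G} → F ≈ᶠ G → pair F ≈ᵗ pair G
  pair-cong {F} {G} eq = cong (wordRows origin) (cells-cong F G eq) , cong (map proj₂) (cells-cong F G eq)

  pair-injective : ∀ {F G} → pair F ≈ᵗ pair G → F ≈ᶠ G
  pair-injective {F} {G} (eqP , eqQ) i with i <? bound G + bound F
  ... | yes lt = trans (sym (positions-word F i)) (trans
    (cong (positions origin) (rsk-injective (word-chain F) (word-chain G)
      (rsk-zeros (word-chain F) (word-vanishes F) (insertion F) (bound G))
      (subst₂ (RSK (word G)) (+-comm (bound F) (bound G)) (sym same)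
        (rsk-zeros (word-chain G) (word-vanishes G) (insertion G) (bound F))) lt))
    (positions-word G i))
    where
    same : cells F ≡ cells G
    same = cells-injective (Valid.cells (cells-valid F)) (Valid.cells (cells-valid G)) eqP eqQ
  ... | no ≮ = trans (vanishes F i (≤-trans (m≤n+m _ (bound G)) (≮⇒≥ ≮)))
                     (sym (vanishes G i (≤-trans (m≤m+n _ (bound F)) (≮⇒≥ ≮))))

  pair-cells : (t : TableauPair S d) → ∃[ i ] ∃[ T ] Valid width i T ×
               wordRows origin T ≡ DyckTableau.rows (P t) × map proj₂ T ≡ SSYT.rows (Q t)
  pair-cells t
    with T , fs , eqP , eqQ ← fill (DyckTableau.rows (P t)) (SSYT.rows (Q t)) (sameShape t) (DyckTableau.rowsDualDyck (P t))
           (All.concat⁻ (All-resp-↭ (↭-sym (entries-P t)) inWindow)) (SSYT.nonempty (Q t)) (SSYT.rowsWeak (Q t))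
           -- One factor more than the largest entry of `Q` is enough; the default 0 serves an empty
           -- `Q`.
           (All.concat⁻ (All.map s≤s (ℕ-Extrema.xs≤max 0 (SSYT.entries (Q t))))) =
    _ , T , valid fs (link fs (subst (Linked _) (sym eqP) (DyckTableau.columns (P t)))
                              (subst (Linked _) (sym eqP) (DyckTableau.decreasing (P t)))
                              (subst (Linked _) (sym eqQ) (SSYT.columnsStrict (Q t)))) , eqP , eqQ

  factorization : (t : TableauPair S d) → ∃[ F ] pair F ≈ᵗ t
  factorization t
    with i , T , V , eqP , eqQ ← pair-cells t
    with f , α , z , R ← unrsk i V =
    F , trans (cong (wordRows origin) same) eqP , trans (cong (map proj₂) same) eqQ
    where
    product≈ : concat (applyUpTo (positions origin ∘ f) i) ≈ bottomUp origin T
    product≈ = rsk-≈ R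
    F : DualDyckFactorization S d
    F = record
      { factors = record
        { factor = positions origin ∘ f
        ; bound = i
        ; vanishes = λ k le → trans (cong (positions origin) (z k le)) (positions-zeros {j = origin} width)
        }
      ; factorizes = ↭-trans (proj₁ product≈) (↭-trans (↭-sym (bottomUp-↭ T))
          (↭-trans (↭-reflexive (cong concat eqP)) (entries-P t)))
      ; dualDyck = λ k → positions-dualDyck {j = origin} (α k)
      ; di-product = trans (proj₂ product≈) (trans
          (cong di (trans (sym (bottomUp-reverse T)) (cong (concat ∘ reverse) eqP))) (di-RR t))
      }
    same : cells F ≡ T
    -- Encoding the decoded factors gives back the words `f`, although the bound may differ in form.
    same = rsk-agree (word-chain F) (λ k → positions-injective (word-chain F k) (α k) (positions-word F k))
      (word-vanishes F) z (insertion F) R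

  bijection : Bijection (DualDyckFactorizations S d) (TableauPairs S d)
  bijection = record
    { to = pair
    ; cong = λ {F} {G} → pair-cong {F} {G}
    ; bijective = (λ {F} {G} → pair-injective {F} {G}) ,
        λ t → proj₁ (factorization t) , λ {G} eq →
          Setoid.trans (TableauPairs S d) {pair G} {pair (proj₁ (factorization t))} {t}
            (pair-cong {G} {proj₁ (factorization t)} eq) (proj₂ (factorization t))
    }

theorem3p18 : (S : List ℤ) (d : ℕ) →
    Σ[ φ ∈ Bijection (DualDyckFactorizations S d) (TableauPairs S d) ]
    ((F : DualDyckFactorization S d) (i : ℕ) →
    SSYT.m (TableauPair.Q (Bijection.to φ F)) i ≡ length (DualDyckFactorization.factor F i))
theorem3p18 S d = bijection S d , Insertion.content S d
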